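{- Let $\lambda \subset \mathbb{N}^2$ be a Young diagram. Then there is a bijection $\sigma \mapsto (\rho, \pi)$ between the set of skew plane partitions $\sigma$ of shape $(\emptyset,\emptyset,\lambda)$ and the set of pairs $(\rho,\pi)$ consisting of a reverse plane partition $\rho$ of shape $(\emptyset,\emptyset,\lambda)$ and a plane partition $\pi$, which is weight-preserving in the sense that $|\sigma| = |\rho| + |\pi|$.
   Context: $\mathbb{N} = \{1,2,\dots\}$ and $\mathbb{N}_{\ge 0} = \{0,1,2,\dots\}$. A partition is a weakly decreasing sequence $\lambda = (\lambda_1,\lambda_2,\dots)$ of nonnegative integers with finitely many nonzero terms; it is identified with its Young diagram $\{(i,j)\in\mathbb{N}^2 \mid 1\le j\le \lambda_i\}$. A plane partition is a function $\pi:\mathbb{N}^2\to\mathbb{N}_{\ge 0}$ with $\pi(i,j)\ge\pi(i+1,j)$ and $\pi(i,j)\ge\pi(i,j+1)$ for all $i,j$, and only finitely many nonzero values. A reverse plane partition (RPP) of shape $(\emptyset,\emptyset,\lambda)$ is a function $\rho:\lambda\to\mathbb{N}_{\ge0}$ with $\rho(i,j)\le\rho(i+1,j)$ and $\rho(i,j)\le\rho(i,j+1)$ whenever both sides are defined. A skew plane partition (SPP) of shape $(\emptyset,\emptyset,\lambda)$ is a function $\sigma:\mathbb{N}^2\setminus\lambda\to\mathbb{N}_{\ge0}$ with $\sigma(i,j)\ge\sigma(i+1,j)$ and $\sigma(i,j)\ge\sigma(i,j+1)$ for all $(i,j)\in\mathbb{N}^2\setminus\lambda$, and only finitely many nonzero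 values. In each case the weight $|\cdot|$ is the sum of all entries. -}

module Defs where

open import Data.Fin.Base using (toℕ)
open import Data.Fin.Properties using (toℕ<n)
open import Data.Nat.Base using (ℕ; suc; _≤_; _<_; _≥_)
open import Data.Nat.Properties using (_<?_; +-0-monoid)
open import Data.Sum.Base using (_⊎_)
open import Relation.Binary.Bundles using (Setoid)
open import Relation.Binary.PropositionalEquality using (_≡_; refl; sym; trans)
open import Relation.Nullary.Decidable.Core using (yes; no)
open import Relation.Nullary.Negation.Core using (¬_)

open import Algebra.Properties.Monoid.Sum +-0-monoid using (sum)

-- Rows and columns are numbered from 0: the pair (i , j) here is the cell
-- (i + 1 , j + 1) of the quadrant {1, 2, …}².

record Partition : Set where
  field
    part       : ℕ → ℕ
    decreasing : ∀ i → part i ≥ part (suc i)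
    length     : ℕ
    finite     : ∀ i → length ≤ i → part i ≡ 0

-- Young diagram of μ.  With 0-based columns, "1 ≤ column ≤ μ_row" is j < part i.
InDiagram : Partition → ℕ → ℕ → Set
InDiagram μ i j = j < Partition.part μ i

-- A subset of the quadrant is a predicate on (i , j); a function on the subset
-- takes its membership proof irrelevantly, so its values depend only on the
-- cell.  Two fillings are equal when they agree at every cell: the setoid
-- equalities below ignore the witnesses of finite support.

-- Finite support means vanishing outside some box [0, bound)², so summing over
-- that box gives the sum of all entries, whichever bound is chosen.

boxSum : ℕ → (ℕ → ℕ → ℕ) → ℕ
boxSum n f = sum {n} λ i → sum {n} λ j → f (toℕ i) (toℕ j)

record PP : Set where
  field
    entry   : ℕ → ℕ → ℕ
    down    : ∀ i j → entry i j ≥ entry (suc i) j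
    right   : ∀ i j → entry i j ≥ entry i (suc j)
    bound   : ℕ
    support : ∀ i j → bound ≤ i ⊎ bound ≤ j → entry i j ≡ 0

  weight : ℕ
  weight = boxSum bound entry

record RPP (μ : Partition) : Set where
  open Partition μ
  field
    entry : ∀ i j → .(InDiagram μ i j) → ℕ
    down  : ∀ i j .(c : InDiagram μ i j) .(c′ : InDiagram μ (suc i) j) →
            entry i j c ≤ entry (suc i) j c′
    right : ∀ i j .(c : InDiagram μ i j) .(c′ : InDiagram μ i (suc j)) →
            entry i j c ≤ entry i (suc j) c′

  weight : ℕ
  weight = sum {length} λ i → sum {part (toℕ i)} λ j →
           entry (toℕ i) (toℕ j) (toℕ<n j)

record SPP (μ : Partition) : Set where
  open Partition μ
  -- In down and right, the hypothesis c′ always follows from c, since the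
  -- complement of a Young diagram is closed under increasing i or j.
  field
    entry   : ∀ i j → .(¬ InDiagram μ i j) → ℕ
    down    : ∀ i j .(c : ¬ InDiagram μ i j) .(c′ : ¬ InDiagram μ (suc i) j) →
              entry i j c ≥ entry (suc i) j c′
    right   : ∀ i j .(c : ¬ InDiagram μ i j) .(c′ : ¬ InDiagram μ i (suc j)) →
              entry i j c ≥ entry i (suc j) c′
    bound   : ℕ
    support : ∀ i j .(c : ¬ InDiagram μ i j) → bound ≤ i ⊎ bound ≤ j →
              entry i j c ≡ 0

  extendByZero : ℕ → ℕ → ℕ
  extendByZero i j with j <? part i
  ... | yes _ = 0
  ... | no  c = entry i j c

  weight : ℕ
  weight = boxSum bound extendByZero

PPₛ : Setoid _ _
PPₛ = record
  { Carrier       = PP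
  ; _≈_           = λ π π′ → ∀ i j → PP.entry π i j ≡ PP.entry π′ i j
  ; isEquivalence = record
    { refl  = λ i j → refl
    ; sym   = λ p i j → sym (p i j)
    ; trans = λ p q i j → trans (p i j) (q i j)
    }
  }

RPPₛ : Partition → Setoid _ _
RPPₛ μ = record
  { Carrier       = RPP μ
  ; _≈_           = λ ρ ρ′ → ∀ i j .(c : InDiagram μ i j) →
                    RPP.entry ρ i j c ≡ RPP.entry ρ′ i j c
  ; isEquivalence = record
    { refl  = λ i j c → refl
    ; sym   = λ p i j c → sym (p i j c)
    ; trans = λ p q i j c → trans (p i j c) (q i j c)
    }
  }

SPPₛ : Partition → Setoid _ _
SPPₛ μ = record
  { Carrier       = SPP μ
  ; _≈_           = λ σ σ′ → ∀ i j .(c : ¬ InDiagram μ i j) →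
                    SPP.entry σ i j c ≡ SPP.entry σ′ i j c
  ; isEquivalence = record
    { refl  = λ i j c → refl
    ; sym   = λ p i j c → sym (p i j c)
    ; trans = λ p q i j c → trans (p i j c) (q i j c)
    }
  }

{-# OPTIONS --safe #-}

-- Cut an array into its diagonals.  Toggling them one after the other with the
-- piecewise-linear (RSK) move  x ↦ min + max - x  strips off the first row and
-- leaves an array on the smaller shape; iterating turns a skew plane partition
-- into a free array on the complement of the diagram, the entry at a cell
-- counting with the length of its hook.  Rotated by 180°, a reverse plane
-- partition is a skew plane partition in a box, so it becomes a free array on
-- the diagram itself.  It remains to match the cells outside the diagram with
-- those inside together with the quadrant, preserving hook lengths.  This goes
-- row by row: the hooks 1, 2, 3, … of the first row outside are the distances
-- from its left end to the earlier steps of the boundary path, vertical steps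
-- corresponding to hooks of the smaller shape and horizontal ones to hooks of
-- the first row inside.
module Submission where

open import Defs
open import Level using (0ℓ)
open import Data.Fin.Base using (toℕ)
open import Data.Fin.Properties using (toℕ<n)
open import Data.Nat.Base
open import Data.Nat.Properties
open import Data.Nat.Tactic.RingSolver using (solve-∀)
open import Data.Product using (Σ; ∃; _×_; _,_; proj₁; proj₂)
open import Data.Product.Function.NonDependent.Setoid using (_×-bijection_)
open import Data.Product.Relation.Binary.Pointwise.NonDependent using (_×ₛ_)
open import Data.Sum.Base using (_⊎_; inj₁; inj₂; [_,_]′)
open import Function.Base using (_∘_; const)
open import Function.Bundles using (Bijection; Inverse)
open import Function.Consequences.Setoid using (strictlySurjective⇒surjective)
import Function.Construct.Composition as Composition
import Function.Construct.Symmetry as Symmetry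
open import Function.Properties.Bijection using (Bijection⇒Inverse)
open import Function.Properties.Inverse using (Inverse⇒Bijection)
open import Relation.Binary.Bundles using (Setoid)
open import Relation.Binary.Definitions using (tri<; tri≈; tri>)
open import Relation.Binary.PropositionalEquality
open import Relation.Nullary using (yes; no; ¬_; contradiction)
open import Relation.Nullary.Decidable using (recompute; ¬?)
open import Algebra.Properties.CommutativeMonoid.Sum +-0-commutativeMonoid
  using (sum; sum-cong-≗; ∑-distrib-+; ∑-comm)

-- Finite sums

-- Hook lengths come from one conservation law. A toggle on a square with corners `d`, `a`, `b`, `t`
-- satisfies |d| + |t| = n + |a| + |b|, where the number `n` spilled by the toggle is the new free
-- entry. Summed along a row of squares, diagonal `p` of the array exceeds diagonal `p` of the
-- smaller array by the free entries at distance at least `p`, so the entry at distance `q` is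
-- counted `suc q` times. Besides, the diagonal of the smaller array through the corner is counted
-- once more, and this supplies the leg cell in the removed row. The obstacle is that rows outside
-- the diagram are infinite: toggles run away from the diagram, but undoing them has to begin where
-- everything already vanishes. Hence bounding boxes are carried along, and passing to free arrays
-- must keep them exactly: for a rotated reverse plane partition, the box is what identifies its
-- free array with one on the diagram.

S : ℕ → (ℕ → ℕ) → ℕ
S n f = sum {n} (f ∘ toℕ)

S-cong : ∀ n {f g} → (∀ i → i < n → f i ≡ g i) → S n f ≡ S n g
S-cong zero    eq = refl
S-cong (suc n) eq = cong₂ _+_ (eq 0 z<s) (S-cong n λ i i<n → eq (suc i) (s<s i<n))

S-cong′ : ∀ n {f g} → (∀ i → f i ≡ g i) → S n f ≡ S n g
S-cong′ n eq = S-cong n λ i _ → eq i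

S-zero : ∀ n {f} → (∀ i → i < n → f i ≡ 0) → S n f ≡ 0
S-zero zero    eq = refl
S-zero (suc n) eq = cong₂ _+_ (eq 0 z<s) (S-zero n λ i i<n → eq (suc i) (s<s i<n))

S-+ : ∀ n f g → S n (λ i → f i + g i) ≡ S n f + S n g
S-+ n f g = ∑-distrib-+ {n} (f ∘ toℕ) (g ∘ toℕ)

S-comm : ∀ m n (f : ℕ → ℕ → ℕ) → S m (λ i → S n (f i)) ≡ S n (λ j → S m (λ i → f i j))
S-comm m n f = ∑-comm {m} {n} λ i j → f (toℕ i) (toℕ j)

S-split : ∀ m n f → S (m + n) f ≡ S m f + S n (f ∘ (m +_))
S-split zero    n f = refl
S-split (suc m) n f = trans (cong (f 0 +_) (S-split m n (f ∘ suc))) (sym (+-assoc (f 0) _ _))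

S-last : ∀ n f → S (suc n) f ≡ S n f + f n
S-last zero    f = +-identityʳ (f 0)
S-last (suc n) f = trans (cong (f 0 +_) (S-last n (f ∘ suc))) (sym (+-assoc (f 0) _ _))

S-rev : ∀ n f → S n f ≡ S n (λ i → f (n ∸ suc i))
S-rev zero    f = refl
S-rev (suc n) f = trans (S-last n f) (trans (+-comm _ (f n)) (cong (f n +_) (S-rev n f)))

VanishesFrom : ℕ → (ℕ → ℕ) → Set
VanishesFrom n f = ∀ i → n ≤ i → f i ≡ 0

S-extend : ∀ {m n} f → VanishesFrom m f → m ≤ n → S n f ≡ S m f
S-extend {m} f v m≤n with m≤n⇒∃[o]m+o≡n m≤n
... | o , refl = trans (S-split m o f)
                 (trans (cong (S m f +_) (S-zero o λ i _ → v (m + i) (m≤m+n m i))) (+-identityʳ _))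

S-splitAt : ∀ m n f → VanishesFrom n f → S n f ≡ S m f + S n (f ∘ (m +_))
S-splitAt m n f v = trans (sym (S-extend f v (m≤n+m n m))) (S-split m n f)

-- The value `f q` occurs in the tails starting at 0, ..., q, hence the factor `suc q`. In
-- `weight-step` this factor becomes the hook length of a cell in the first row.
S-tails : ∀ n f → VanishesFrom n f →
          S n (λ p → S n (λ q → f (q + p))) ≡ S n (λ q → suc q * f q)
S-tails zero    f v = refl
S-tails (suc n) f v = begin
  S (suc n) (λ q → f (q + 0)) + S n (λ p → S (suc n) (λ q → f (q + suc p)))
    ≡⟨ cong₂ _+_ (S-cong′ (suc n) λ q → cong f (+-identityʳ q)) (S-cong′ n drop) ⟩
  f 0 + S n (f ∘ suc) + S n (λ p → S n (λ q → f (suc (q + p))))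
    ≡⟨ cong (f 0 + S n (f ∘ suc) +_) (S-tails n (f ∘ suc) λ i le → v (suc i) (s≤s le)) ⟩
  f 0 + S n (f ∘ suc) + S n (λ q → suc q * f (suc q))
    ≡⟨ cong (λ x → x + S n (f ∘ suc) + S n (λ q → suc q * f (suc q))) (sym (+-identityʳ (f 0))) ⟩
  f 0 + 0 + S n (f ∘ suc) + S n (λ q → suc q * f (suc q))
    ≡⟨ +-assoc (f 0 + 0) _ _ ⟩
  f 0 + 0 + (S n (f ∘ suc) + S n (λ q → suc q * f (suc q)))
    ≡⟨ cong (f 0 + 0 +_) (sym (S-+ n (f ∘ suc) (λ q → suc q * f (suc q)))) ⟩
  f 0 + 0 + S n (λ q → suc (suc q) * f (suc q)) ∎
  where
  open ≡-Reasoning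
  drop : ∀ p → S (suc n) (λ q → f (q + suc p)) ≡ S n (λ q → f (suc (q + p)))
  drop p = begin
    S (suc n) (λ q → f (q + suc p))         ≡⟨ S-last n (λ q → f (q + suc p)) ⟩
    S n (λ q → f (q + suc p)) + f (n + suc p)
      ≡⟨ cong₂ _+_ (S-cong′ n λ q → cong f (+-suc q p)) (v _ (subst (suc n ≤_) (sym (+-suc n p)) (s≤s (m≤m+n n p)))) ⟩
    S n (λ q → f (suc (q + p))) + 0         ≡⟨ +-identityʳ _ ⟩
    S n (λ q → f (suc (q + p)))             ∎

-- Interlacing sequences and toggles

infix 4 _≺_

_≺_ : (ℕ → ℕ) → (ℕ → ℕ) → Set
a ≺ b = ∀ k → a k ≤ b k × b (suc k) ≤ a k

toggle : (a b d : ℕ → ℕ) → ℕ → ℕ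
toggle a b d k = (a k ⊓ b k) + (a (suc k) ⊔ b (suc k)) ∸ d (suc k)

toggle-+ : ∀ {a b d} → a ≺ d → b ≺ d → ∀ k →
           d (suc k) + toggle a b d k ≡ (a k ⊓ b k) + (a (suc k) ⊔ b (suc k))
toggle-+ a≺d b≺d k = m+[n∸m]≡n (≤-trans (⊓-glb (proj₂ (a≺d k)) (proj₂ (b≺d k))) (m≤m+n _ _))

-- In x + t ≡ m + M, the bounds M ≤ x ≤ m are equivalent to M ≤ t ≤ m.
exchange-≤ : ∀ {x t m M} → x + t ≡ m + M → M ≤ x → t ≤ m
exchange-≤ {x} {t} {m} {M} eq M≤x = +-cancelˡ-≤ M t m (begin
  M + t ≤⟨ +-monoˡ-≤ t M≤x ⟩
  x + t ≡⟨ eq ⟩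
  m + M ≡⟨ +-comm m M ⟩
  M + m ∎)
  where open ≤-Reasoning

exchange-≥ : ∀ {x t m M} → x + t ≡ m + M → x ≤ m → M ≤ t
exchange-≥ {x} {t} {m} {M} eq x≤m = +-cancelˡ-≤ m M t (begin
  m + M ≡⟨ eq ⟨
  x + t ≤⟨ +-monoˡ-≤ t x≤m ⟩
  m + t ∎)
  where open ≤-Reasoning

toggle-≺ : ∀ {a b d} → a ≺ d → b ≺ d → toggle a b d ≺ a × toggle a b d ≺ b
toggle-≺ {a} {b} {d} a≺d b≺d =
  (λ k → ≤-trans (hi k) (m⊓n≤m _ _) , ≤-trans (m≤m⊔n _ _) (lo k)) ,
  (λ k → ≤-trans (hi k) (m⊓n≤n _ _) , ≤-trans (m≤n⊔m (a (suc k)) _) (lo k))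
  where
  hi : ∀ k → toggle a b d k ≤ a k ⊓ b k
  hi k = exchange-≤ {x = d (suc k)} (toggle-+ {a} {b} a≺d b≺d k)
           (⊔-lub (proj₁ (a≺d (suc k))) (proj₁ (b≺d (suc k))))
  lo : ∀ k → a (suc k) ⊔ b (suc k) ≤ toggle a b d k
  lo k = exchange-≥ {x = d (suc k)} (toggle-+ {a} {b} a≺d b≺d k)
           (⊓-glb (proj₂ (a≺d k)) (proj₂ (b≺d k)))

-- Since min + max - x is an involution, the same formula recovers the largest corner. Only its
-- entry 0, which has no upper bound, requires the additional datum `n`.
untoggle : (n : ℕ) (a b t : ℕ → ℕ) → ℕ → ℕ
untoggle n a b t zero    = n + (a 0 ⊔ b 0)
untoggle n a b t (suc k) = (a k ⊓ b k) + (a (suc k) ⊔ b (suc k)) ∸ t k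

untoggle-+ : ∀ n {a b t} → t ≺ a → t ≺ b → ∀ k →
             untoggle n a b t (suc k) + t k ≡ (a k ⊓ b k) + (a (suc k) ⊔ b (suc k))
untoggle-+ n t≺a t≺b k = m∸n+n≡m (≤-trans (⊓-glb (proj₁ (t≺a k)) (proj₁ (t≺b k))) (m≤m+n _ _))

untoggle-≺ : ∀ n {a b t} → t ≺ a → t ≺ b → a ≺ untoggle n a b t × b ≺ untoggle n a b t
untoggle-≺ n {a} {b} {t} t≺a t≺b =
  (λ k → ≤-trans (m≤m⊔n _ _) (lo k) , ≤-trans (hi k) (m⊓n≤m _ _)) ,
  (λ k → ≤-trans (m≤n⊔m (a k) _) (lo k) , ≤-trans (hi k) (m⊓n≤n _ _))
  where
  d = untoggle n a b t
  swapped : ∀ k → t k + d (suc k) ≡ (a k ⊓ b k) + (a (suc k) ⊔ b (suc k))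
  swapped k = trans (+-comm (t k) _) (untoggle-+ n {a} {b} t≺a t≺b k)
  hi : ∀ k → d (suc k) ≤ a k ⊓ b k
  hi k = exchange-≤ {x = t k} (swapped k) (⊔-lub (proj₂ (t≺a k)) (proj₂ (t≺b k)))
  lo : ∀ k → a k ⊔ b k ≤ d k
  lo zero    = m≤n+m _ n
  lo (suc k) = exchange-≥ {x = t k} (swapped k) (⊓-glb (proj₁ (t≺a k)) (proj₁ (t≺b k)))

-- Row insertion

Decreasing : (ℕ → ℕ → ℕ) → Set
Decreasing D = ∀ p → D (suc p) ≺ D p

-- A row of squares of a growth diagram: in square `p` the largest corner is `D p`, the smallest
-- `D′ (suc p)`, and `D′ p` and `D (suc p)` lie between. The rules are additive equations, so they
-- can be solved in both directions: for `D′` and `n` with increasing `p`, or for `D` with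
-- decreasing `p`.
record Insertion (D D′ : ℕ → ℕ → ℕ) (n : ℕ → ℕ) : Set where
  constructor insertion
  field
    head  : ∀ p → D p 0 ≡ n p + (D′ p 0 ⊔ D (suc p) 0)
    local : ∀ p k → D p (suc k) + D′ (suc p) k
                    ≡ (D′ p k ⊓ D (suc p) k) + (D′ p (suc k) ⊔ D (suc p) (suc k))

open Insertion

shift : ∀ {D D′ n} → Insertion D D′ n → Insertion (D ∘ suc) (D′ ∘ suc) (n ∘ suc)
shift I = insertion (head I ∘ suc) (local I ∘ suc)

bump : (α : ℕ → ℕ) (D : ℕ → ℕ → ℕ) → ℕ → ℕ → ℕ
bump α D zero    = α
bump α D (suc p) = toggle (bump α D p) (D (suc p)) (D p)

spill : (α : ℕ → ℕ) (D : ℕ → ℕ → ℕ) → ℕ → ℕ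
spill α D p = D p 0 ∸ (bump α D p 0 ⊔ D (suc p) 0)

module _ {α : ℕ → ℕ} {D : ℕ → ℕ → ℕ} (α≺D : α ≺ D 0) (dec : Decreasing D) where

  bump-≺ : ∀ p → bump α D p ≺ D p
  bump-≺ zero    = α≺D
  bump-≺ (suc p) = proj₂ (toggle-≺ (bump-≺ p) (dec p))

  bump-decreasing : Decreasing (bump α D)
  bump-decreasing p = proj₁ (toggle-≺ (bump-≺ p) (dec p))

  bump-insertion : Insertion D (bump α D) (spill α D)
  bump-insertion = insertion
    (λ p → sym (m∸n+n≡m (⊔-lub (proj₁ (bump-≺ p 0)) (proj₁ (dec p 0)))))
    (λ p → toggle-+ (bump-≺ p) (dec p))

bump-cong : ∀ {α β D E} → (∀ k → α k ≡ β k) → (∀ p k → D p k ≡ E p k) →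
            ∀ p k → bump α D p k ≡ bump β E p k
bump-cong α≗β D≗E zero    k = α≗β k
bump-cong α≗β D≗E (suc p) k = cong₂ _∸_
  (cong₂ _+_ (cong₂ _⊓_ (bump-cong α≗β D≗E p k) (D≗E (suc p) k))
             (cong₂ _⊔_ (bump-cong α≗β D≗E p (suc k)) (D≗E (suc p) (suc k))))
  (D≗E p (suc k))

spill-cong : ∀ {α β D E} → (∀ k → α k ≡ β k) → (∀ p k → D p k ≡ E p k) →
             ∀ p → spill α D p ≡ spill β E p
spill-cong α≗β D≗E p = cong₂ _∸_ (D≗E p 0)
  (cong₂ _⊔_ (bump-cong α≗β D≗E p 0) (D≗E (suc p) 0))

insertion⇒bump : ∀ {D D′ n} → Insertion D D′ n → ∀ p k → D′ p k ≡ bump (D′ 0) D p k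
insertion⇒bump I zero    k = refl
insertion⇒bump {D} {D′} I (suc p) k = begin
  D′ (suc p) k                              ≡⟨ m+n∸m≡n (D p (suc k)) _ ⟨
  D p (suc k) + D′ (suc p) k ∸ D p (suc k)  ≡⟨ cong (_∸ D p (suc k)) (local I p k) ⟩
  toggle (D′ p) (D (suc p)) (D p) k
    ≡⟨ cong (_∸ D p (suc k)) (cong₂ (λ x y → (x ⊓ D (suc p) k) + (y ⊔ D (suc p) (suc k)))
         (insertion⇒bump I p k) (insertion⇒bump I p (suc k))) ⟩
  bump (D′ 0) D (suc p) k                   ∎
  where open ≡-Reasoning

insertion⇒spill : ∀ {D D′ n} → Insertion D D′ n → ∀ p → n p ≡ spill (D′ 0) D p
insertion⇒spill {D} {D′} {n} I p = begin
  n p                                      ≡⟨ m+n∸n≡m (n p) (D′ p 0 ⊔ D (suc p) 0) ⟨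
  n p + (D′ p 0 ⊔ D (suc p) 0) ∸ (D′ p 0 ⊔ D (suc p) 0)
    ≡⟨ cong₂ _∸_ (sym (head I p)) (cong (_⊔ D (suc p) 0) (insertion⇒bump I p 0)) ⟩
  spill (D′ 0) D p                         ∎
  where open ≡-Reasoning

-- Square `p` determines `D p` from `D (suc p)`, `D′` and the spilled number, so the induction comes
-- back from the far end, where both arrays vanish.
insertion-injective : ∀ b {D E D′ E′ m n} → Insertion D D′ m → Insertion E E′ n →
  (∀ p k → D′ p k ≡ E′ p k) → (∀ p → m p ≡ n p) →
  (∀ p → b ≤ p → ∀ k → D p k ≡ 0) → (∀ p → b ≤ p → ∀ k → E p k ≡ 0) →
  ∀ p k → D p k ≡ E p k
insertion-injective zero    I J D′≗E′ m≗n D-zero E-zero p k = trans (D-zero p z≤n k) (sym (E-zero p z≤n k))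
insertion-injective (suc b) {D} {E} {D′} {E′} {m} {n} I J D′≗E′ m≗n D-zero E-zero = λ where
    (suc p) k       → tail p k
    zero    zero    → trans (head I 0) (trans (cong₂ _+_ (m≗n 0) (cong₂ _⊔_ (D′≗E′ 0 0) (tail 0 0))) (sym (head J 0)))
    zero    (suc k) → +-cancelʳ-≡ (E′ 1 k) _ _ (trans (cong (D 0 (suc k) +_) (sym (D′≗E′ 1 k)))
      (trans (local I 0 k)
      (trans (cong₂ _+_ (cong₂ _⊓_ (D′≗E′ 0 k) (tail 0 k)) (cong₂ _⊔_ (D′≗E′ 0 (suc k)) (tail 0 (suc k))))
             (sym (local J 0 k)))))
  where
  tail = insertion-injective b (shift I) (shift J) (D′≗E′ ∘ suc) (m≗n ∘ suc)
           (λ p le → D-zero (suc p) (s≤s le)) (λ p le → E-zero (suc p) (s≤s le))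

-- Starting with the zero array at the far end, each `untoggle` adds one diagonal in front. The
-- relation `D′ p ≺ D p` is part of the conclusion because the next `untoggle` depends on it.
insertion-surjective : ∀ b {D′ n} → Decreasing D′ →
  (∀ p → b ≤ p → ∀ k → D′ p k ≡ 0) → VanishesFrom b n →
  Σ (ℕ → ℕ → ℕ) λ D → Insertion D D′ n × Decreasing D × (∀ p → D′ p ≺ D p) ×
                      (∀ p → b ≤ p → ∀ k → D p k ≡ 0)
insertion-surjective zero {D′} {n} dec D′-zero n-zero =
  (λ _ _ → 0) ,
  insertion (λ p → sym (cong₂ _+_ (n-zero p z≤n) (cong (_⊔ 0) (D′-zero p z≤n 0))))
            (λ p k → trans (D′-zero (suc p) z≤n k)
              (sym (cong₂ _+_ (⊓-zeroʳ (D′ p k)) (cong (_⊔ 0) (D′-zero p z≤n (suc k)))))) ,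
  (λ p k → z≤n , z≤n) ,
  (λ p k → ≤-reflexive (D′-zero p z≤n k) , z≤n) ,
  (λ p _ k → refl)
insertion-surjective (suc b) {D′} {n} dec D′-zero n-zero
  with insertion-surjective b (dec ∘ suc) (λ p le → D′-zero (suc p) (s≤s le)) (λ p le → n-zero (suc p) (s≤s le))
... | T , I , decT , D′≺T , T-zero = D , I′ , dec′ , D′≺D , D-zero
  where
  D : ℕ → ℕ → ℕ
  D zero    = untoggle (n 0) (D′ 0) (T 0) (D′ 1)
  D (suc p) = T p
  I′ : Insertion D D′ n
  I′ = insertion (λ { zero → refl ; (suc p) → head I p })
                 (λ { zero → untoggle-+ (n 0) (dec 0) (D′≺T 0) ; (suc p) → local I p })
  dec′ : Decreasing D
  dec′ zero    = proj₂ (untoggle-≺ (n 0) (dec 0) (D′≺T 0))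
  dec′ (suc p) = decT p
  D′≺D : ∀ p → D′ p ≺ D p
  D′≺D zero    = proj₁ (untoggle-≺ (n 0) (dec 0) (D′≺T 0))
  D′≺D (suc p) = D′≺T p
  D-zero : ∀ p → suc b ≤ p → ∀ k → D p k ≡ 0
  D-zero (suc p) (s≤s le) = T-zero p le

-- Conservation of sums under insertion

⊓+⊔ : ∀ m n → (m ⊓ n) + (m ⊔ n) ≡ m + n
⊓+⊔ zero    n       = refl
⊓+⊔ (suc m) zero    = sym (+-identityʳ (suc m))
⊓+⊔ (suc m) (suc n) = cong suc (trans (+-suc (m ⊓ n) (m ⊔ n)) (trans (cong suc (⊓+⊔ m n)) (sym (+-suc m n))))

module _ (r : ℕ) where

  -- The local equations pair each minimum with the next maximum. The maximum left over,
  -- `a 0 ⊔ b 0`, is provided by `d 0`, and then minima and maxima recombine entrywise into `a` and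
  -- `b`.
  toggle-sum : ∀ n {a b d t : ℕ → ℕ} → VanishesFrom r a → VanishesFrom r b → VanishesFrom r d →
    d 0 ≡ n + (a 0 ⊔ b 0) →
    (∀ k → d (suc k) + t k ≡ (a k ⊓ b k) + (a (suc k) ⊔ b (suc k))) →
    S r d + S r t ≡ n + S r a + S r b
  toggle-sum n {a} {b} {d} {t} va vb vd eq₀ eq = begin
    S r d + S r t                        ≡⟨ cong (_+ S r t) (sym (S-extend d vd (n≤1+n r))) ⟩
    d 0 + S r (d ∘ suc) + S r t          ≡⟨ +-assoc (d 0) _ _ ⟩
    d 0 + (S r (d ∘ suc) + S r t)        ≡⟨ cong₂ _+_ eq₀ (sym (S-+ r (d ∘ suc) t)) ⟩
    n + M 0 + S r (λ k → d (suc k) + t k) ≡⟨ cong (n + M 0 +_) (S-cong′ r eq) ⟩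
    n + M 0 + S r (λ k → m k + M (suc k)) ≡⟨ cong (n + M 0 +_) (S-+ r m (M ∘ suc)) ⟩
    n + M 0 + (S r m + S r (M ∘ suc))    ≡⟨ rearrange n (M 0) (S r m) (S r (M ∘ suc)) ⟩
    n + (S r m + (M 0 + S r (M ∘ suc)))  ≡⟨ cong (λ x → n + (S r m + x)) (S-extend M vM (n≤1+n r)) ⟩
    n + (S r m + S r M)                  ≡⟨ cong (n +_) (sym (S-+ r m M)) ⟩
    n + S r (λ k → m k + M k)            ≡⟨ cong (n +_) (S-cong′ r λ k → ⊓+⊔ (a k) (b k)) ⟩
    n + S r (λ k → a k + b k)            ≡⟨ cong (n +_) (S-+ r a b) ⟩
    n + (S r a + S r b)                  ≡⟨ sym (+-assoc n _ _) ⟩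
    n + S r a + S r b                    ∎
    where
    open ≡-Reasoning
    m M : ℕ → ℕ
    m k = a k ⊓ b k
    M k = a k ⊔ b k
    vM : VanishesFrom r M
    vM i le = cong₂ _⊔_ (va i le) (vb i le)
    rearrange : ∀ w x y z → w + x + (y + z) ≡ w + (y + (x + z))
    rearrange = solve-∀

  -- By `toggle-sum`, the difference between the sums of `D p` and `D′ p` drops by exactly `n p`
  -- from `p` to `suc p`, and it is 0 at the far end.
  insertion-sum₀ : ∀ b {D D′ n} → Insertion D D′ n →
    (∀ p → VanishesFrom r (D p)) → (∀ p → VanishesFrom r (D′ p)) →
    (∀ p → b ≤ p → ∀ k → D p k ≡ 0) → (∀ p → b ≤ p → ∀ k → D′ p k ≡ 0) →
    S r (D 0) ≡ S b n + S r (D′ 0)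
  insertion-sum₀ zero I vD vD′ D-zero D′-zero =
    trans (S-zero r λ k _ → D-zero 0 z≤n k) (sym (S-zero r λ k _ → D′-zero 0 z≤n k))
  insertion-sum₀ (suc b) {D} {D′} {n} I vD vD′ D-zero D′-zero =
    +-cancelʳ-≡ (S r (D′ 1)) _ _ (begin
      S r (D 0) + S r (D′ 1)
        ≡⟨ toggle-sum (n 0) (vD′ 0) (vD 1) (vD 0) (head I 0) (local I 0) ⟩
      n 0 + S r (D′ 0) + S r (D 1)
        ≡⟨ cong (n 0 + S r (D′ 0) +_) (insertion-sum₀ b (shift I) (vD ∘ suc) (vD′ ∘ suc)
             (λ p le → D-zero (suc p) (s≤s le)) (λ p le → D′-zero (suc p) (s≤s le))) ⟩
      n 0 + S r (D′ 0) + (S b (n ∘ suc) + S r (D′ 1))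
        ≡⟨ rearrange (n 0) (S r (D′ 0)) (S b (n ∘ suc)) (S r (D′ 1)) ⟩
      n 0 + S b (n ∘ suc) + S r (D′ 0) + S r (D′ 1) ∎)
    where
    open ≡-Reasoning
    rearrange : ∀ w x y z → w + x + (y + z) ≡ w + y + x + z
    rearrange = solve-∀

  insertion-sum : ∀ b {D D′ n} → Insertion D D′ n →
    (∀ p → VanishesFrom r (D p)) → (∀ p → VanishesFrom r (D′ p)) →
    (∀ p → b ≤ p → ∀ k → D p k ≡ 0) → (∀ p → b ≤ p → ∀ k → D′ p k ≡ 0) →
    ∀ p → S r (D p) ≡ S b (λ q → n (q + p)) + S r (D′ p)
  insertion-sum b {n = n} I vD vD′ D-zero D′-zero zero =
    trans (insertion-sum₀ b I vD vD′ D-zero D′-zero)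
      (cong (_+ _) (S-cong′ b λ q → cong n (sym (+-identityʳ q))))
  insertion-sum b {n = n} I vD vD′ D-zero D′-zero (suc p) =
    trans (insertion-sum b (shift I) (vD ∘ suc) (vD′ ∘ suc)
            (λ q le → D-zero (suc q) (m≤n⇒m≤1+n le)) (λ q le → D′-zero (suc q) (m≤n⇒m≤1+n le)) p)
      (cong (_+ _) (S-cong′ b λ q → cong n (sym (+-suc q p))))

-- Row extraction

-- A shape is the sequence s of first columns outside the diagram; arrays are
-- total and only their values at the cells with s i ≤ j matter.

Array : Set
Array = ℕ → ℕ → ℕ

Antitone : (ℕ → ℕ) → Set
Antitone s = ∀ i → s (suc i) ≤ s i

antitone₀ : ∀ {s} → Antitone s → ∀ i → s i ≤ s 0
antitone₀ anti zero    = ≤-refl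
antitone₀ anti (suc i) = ≤-trans (anti i) (antitone₀ anti i)

record IsSkew (s : ℕ → ℕ) (e : Array) : Set where
  field
    down  : ∀ i j → s i ≤ j → e (suc i) j ≤ e i j
    right : ∀ i j → s i ≤ j → e i (suc j) ≤ e i j

open IsSkew

column-≤ : ∀ {s e} → Antitone s → IsSkew s e → ∀ i {j} → s 0 ≤ j → e i j ≤ e 0 j
column-≤ anti sk zero    s₀≤j = ≤-refl
column-≤ anti sk (suc i) s₀≤j =
  ≤-trans (down sk i _ (≤-trans (antitone₀ anti i) s₀≤j)) (column-≤ anti sk i s₀≤j)

Agree : (s : ℕ → ℕ) → Array → Array → Set
Agree s e f = ∀ i j → s i ≤ j → e i j ≡ f i j

Bounded : (s : ℕ → ℕ) (r c : ℕ) → Array → Set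
Bounded s r c e = ∀ i j → s i ≤ j → r ≤ i ⊎ c ≤ j → e i j ≡ 0

diagonal : ℕ → Array → ℕ → ℕ → ℕ
diagonal m e p k = e k (k + (p + m))

data Side (m k : ℕ) : ℕ → Set where
  west : ∀ {c} → c < k + m → Side m k c
  east : ∀ p → Side m k (k + (p + m))

side : ∀ m k c → Side m k c
side m k c with c <? k + m
... | yes c<k+m = west c<k+m
... | no  c≮k+m = subst (Side m k) eq (east (c ∸ (k + m)))
  where
  rearrange : ∀ x y z → x + (y + z) ≡ x + z + y
  rearrange = solve-∀
  eq : k + (c ∸ (k + m) + m) ≡ c
  eq = trans (rearrange k (c ∸ (k + m)) m) (m+[n∸m]≡n (≮⇒≥ c≮k+m))

paste : ℕ → Array → (ℕ → ℕ → ℕ) → Array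
paste m a D k c with c <? k + m
... | yes _ = a k c
... | no  _ = D (c ∸ (k + m)) k

paste-left : ∀ m a D {k c} → c < k + m → paste m a D k c ≡ a k c
paste-left m a D {k} {c} c<k+m with c <? k + m
... | yes _     = refl
... | no  c≮k+m = contradiction c<k+m c≮k+m

paste-right : ∀ m a D p k → paste m a D k (k + (p + m)) ≡ D p k
paste-right m a D p k with k + (p + m) <? k + m
... | yes lt = contradiction lt (≤⇒≯ (+-monoʳ-≤ k (m≤n+m m p)))
... | no  _  = cong (λ x → D x k)
  (trans ([m+n]∸[m+o]≡n∸o k (p + m) m) (m+n∸n≡m p m))

-- The diagonal just west of `diagonal m e 0`. For `m` equal to `s 0`, its cell in row 0 would lie
-- in the diagram or off the quadrant, hence the start in row 1.
below : ℕ → Array → ℕ → ℕ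
below m e k = e (suc k) (k + m)

-- West of the corner no diagonal has a cell of row 0 outside the diagram, so nothing is toggled
-- there and the array only moves up by one row. On the diagonal `c ≡ k + s 0` both rules give the
-- same value, because `bump` starts from `below`; this is why `rest-low` includes equality.
rest : (s : ℕ → ℕ) → Array → Array
rest s e = paste (s 0) (e ∘ suc) (bump (below (s 0) e) (diagonal (s 0) e))

firstRow : (s : ℕ → ℕ) → Array → ℕ → ℕ
firstRow s e c = spill (below (s 0) e) (diagonal (s 0) e) (c ∸ s 0)

rest-low : ∀ s e {k c} → c ≤ k + s 0 → rest s e k c ≡ e (suc k) c
rest-low s e {k} {c} c≤k+m with m≤n⇒m<n∨m≡n c≤k+m
... | inj₁ c<k+m = paste-left (s 0) _ _ c<k+m
... | inj₂ refl  = paste-right (s 0) _ _ 0 k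

rest-high : ∀ s e p k → rest s e k (k + (p + s 0)) ≡ bump (below (s 0) e) (diagonal (s 0) e) p k
rest-high s e = paste-right (s 0) _ _

firstRow-+ : ∀ s e p → firstRow s e (p + s 0) ≡ spill (below (s 0) e) (diagonal (s 0) e) p
firstRow-+ s e p = cong (spill (below (s 0) e) (diagonal (s 0) e)) (m+n∸n≡m p (s 0))

module _ {s : ℕ → ℕ} (anti : Antitone s) where

  private m = s 0

  in-region : ∀ k p → s k ≤ k + (p + m)
  in-region k p = ≤-trans (antitone₀ anti k) (≤-trans (m≤n+m m p) (m≤n+m _ k))

  Agree-diagonal : ∀ {e f} → Agree s e f → ∀ p k → diagonal m e p k ≡ diagonal m f p k
  Agree-diagonal e≗f p k = e≗f k _ (in-region k p)

  Agree-below : ∀ {e f} → Agree s e f → ∀ k → below m e k ≡ below m f k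
  Agree-below e≗f k = e≗f (suc k) _ (≤-trans (anti k) (in-region k 0))

  rest-cong : ∀ {e f} → Agree s e f → Agree (s ∘ suc) (rest s e) (rest s f)
  rest-cong {e} {f} e≗f k c s≤c with side m k c
  ... | west c<k+m = trans (rest-low s e (<⇒≤ c<k+m))
                     (trans (e≗f (suc k) c s≤c) (sym (rest-low s f (<⇒≤ c<k+m))))
  ... | east p    = trans (rest-high s e p k)
                     (trans (bump-cong (Agree-below e≗f) (Agree-diagonal e≗f) p k) (sym (rest-high s f p k)))

  firstRow-cong : ∀ {e f} → Agree s e f → ∀ c → firstRow s e c ≡ firstRow s f c
  firstRow-cong e≗f c = spill-cong (Agree-below e≗f) (Agree-diagonal e≗f) (c ∸ m)

  diagonal-decreasing : ∀ {e} → IsSkew s e → Decreasing (diagonal m e)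
  diagonal-decreasing {e} sk p k =
    subst (λ c → e k c ≤ diagonal m e p k) (sym (+-suc k (p + m))) (right sk k _ (in-region k p)) ,
    subst (λ c → diagonal m e p (suc k) ≤ e k c) (sym (+-suc k (p + m)))
      (down sk k _ (≤-trans (in-region k p) (n≤1+n _)))

  below-≺ : ∀ {e} → IsSkew s e → below m e ≺ diagonal m e 0
  below-≺ sk k = down sk k _ (in-region k 0) ,
                 right sk (suc k) _ (≤-trans (anti k) (in-region k 0))

  module _ {e : Array} (sk : IsSkew s e) where

    bump-rest : ∀ p k → diagonal m (rest s e) p k ≡ bump (below m e) (diagonal m e) p k
    bump-rest = rest-high s e

    rest-insertion : Insertion (diagonal m e) (diagonal m (rest s e)) (firstRow s e ∘ (_+ m))
    rest-insertion = insertion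
      (λ p → trans (Insertion.head I p)
        (cong₂ (λ x y → x + (y ⊔ diagonal m e (suc p) 0)) (sym (firstRow-+ s e p)) (sym (bump-rest p 0))))
      (λ p k → trans (cong (diagonal m e p (suc k) +_) (bump-rest (suc p) k))
        (trans (Insertion.local I p k)
          (cong₂ (λ x y → (x ⊓ diagonal m e (suc p) k) + (y ⊔ diagonal m e (suc p) (suc k)))
            (sym (bump-rest p k)) (sym (bump-rest p (suc k))))))
      where I = bump-insertion (below-≺ sk) (diagonal-decreasing sk)

    rest-skew : IsSkew (s ∘ suc) (rest s e)
    rest-skew .right k c s≤c with side m k c
    ... | west c<k+m = subst₂ _≤_ (sym (rest-low s e c<k+m)) (sym (rest-low s e (<⇒≤ c<k+m)))
                         (right sk (suc k) c s≤c)
    ... | east p    = subst₂ _≤_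
                         (trans (sym (bump-rest (suc p) k)) (cong (rest s e k) (+-suc k (p + m))))
                         (sym (bump-rest p k))
                         (proj₁ (bump-decreasing (below-≺ sk) (diagonal-decreasing sk) p k))
    rest-skew .down k c s≤c with side m k c
    ... | west c<k+m    = subst₂ _≤_ (sym (rest-low s e (≤-trans (<⇒≤ c<k+m) (n≤1+n _))))
                            (sym (rest-low s e (<⇒≤ c<k+m))) (down sk (suc k) c s≤c)
    ... | east zero    = subst₂ _≤_ (sym (rest-low s e (n≤1+n _))) (sym (rest-low s e ≤-refl))
                            (down sk (suc k) c s≤c)
    ... | east (suc p) = subst₂ _≤_
                            (trans (sym (bump-rest p (suc k))) (cong (rest s e (suc k)) (sym (+-suc k (p + m)))))
                            (sym (bump-rest (suc p) k))
                            (proj₂ (bump-decreasing (below-≺ sk) (diagonal-decreasing sk) p k))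

    -- Two comparisons are combined. The bumped diagonals descend from `below`, which is read one
    -- row lower and so loses a row of support; and each is dominated by the diagonal of `e` with
    -- the same index, which gives the column bound.
    rest-bounded : ∀ {r c} → Bounded s (suc r) c e → Bounded (s ∘ suc) r c (rest s e)
    rest-bounded bd k j s≤j b with side m k j
    ... | west j<k+m = trans (rest-low s e (<⇒≤ j<k+m)) (bd (suc k) j s≤j ([ inj₁ ∘ s≤s , inj₂ ]′ b))
    ... | east p = n≤0⇒n≡0 (≤-trans (≤-reflexive (bump-rest p k)) (bounds b))
      where
      bump≤below : ∀ p → bump (below m e) (diagonal m e) p k ≤ below m e k
      bump≤below zero    = ≤-refl
      bump≤below (suc p) = ≤-trans (proj₁ (bump-decreasing (below-≺ sk) (diagonal-decreasing sk) p k)) (bump≤below p)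
      bounds : _ → bump (below m e) (diagonal m e) p k ≤ 0
      bounds (inj₁ r≤k) = ≤-trans (bump≤below p)
        (≤-reflexive (bd (suc k) _ (≤-trans (anti k) (in-region k 0)) (inj₁ (s≤s r≤k))))
      bounds (inj₂ c≤j) = ≤-trans (proj₁ (bump-≺ (below-≺ sk) (diagonal-decreasing sk) p k))
        (≤-reflexive (bd k _ (in-region k p) (inj₂ c≤j)))

    firstRow-≤ : ∀ j → m ≤ j → firstRow s e j ≤ e 0 j
    firstRow-≤ j m≤j = ≤-trans
      (m∸n≤m _ (bump (below m e) (diagonal m e) (j ∸ m) 0 ⊔ diagonal m e (suc (j ∸ m)) 0))
      (≤-reflexive (cong (e 0) (m∸n+n≡m m≤j)))

  diagonal-zero : ∀ {r c e} → Bounded s r c e → ∀ p → c ≤ p → ∀ k → diagonal m e p k ≡ 0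
  diagonal-zero bd p c≤p k = bd k _ (in-region k p) (inj₂ (≤-trans c≤p (≤-trans (m≤m+n p m) (m≤n+m _ k))))

  diagonal-vanishes : ∀ {r c e} → Bounded s r c e → ∀ p → VanishesFrom r (diagonal m e p)
  diagonal-vanishes bd p k r≤k = bd k _ (in-region k p) (inj₁ r≤k)

  rest-diagonal-zero : ∀ {r c e} → Bounded (s ∘ suc) r c e → ∀ p → c ≤ p → ∀ k → diagonal m e p k ≡ 0
  rest-diagonal-zero bd p c≤p k = bd k _ (≤-trans (anti k) (in-region k p))
    (inj₂ (≤-trans c≤p (≤-trans (m≤m+n p m) (m≤n+m _ k))))

  rest-diagonal-vanishes : ∀ {r c e} → Bounded (s ∘ suc) r c e → ∀ p → VanishesFrom r (diagonal m e p)
  rest-diagonal-vanishes bd p k r≤k = bd k _ (≤-trans (anti k) (in-region k p)) (inj₁ r≤k)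

  extraction-injective : ∀ {r c e f} → IsSkew s e → IsSkew s f → Bounded s r c e → Bounded s r c f →
    (∀ j → m ≤ j → firstRow s e j ≡ firstRow s f j) → Agree (s ∘ suc) (rest s e) (rest s f) → Agree s e f
  extraction-injective {r} {c} {e} {f} ske skf bde bdf row≗ rest≗ k j s≤j with side m k j
  ... | east p = insertion-injective c (rest-insertion ske) (rest-insertion skf)
                    (λ p k → rest≗ k _ (≤-trans (anti k) (in-region k p)))
                    (λ p → row≗ _ (m≤n+m m p)) (diagonal-zero bde) (diagonal-zero bdf) p k
  extraction-injective {r} {c} {e} {f} ske skf bde bdf row≗ rest≗ zero    j s≤j | west j<m =
    contradiction s≤j (<⇒≱ j<m)
  extraction-injective {r} {c} {e} {f} ske skf bde bdf row≗ rest≗ (suc k) j s≤j | west j<m =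
    trans (sym (rest-low s e (≤-pred j<m))) (trans (rest≗ k j s≤j) (rest-low s f (≤-pred j<m)))

  extraction-surjective : ∀ {r c n e′} → IsSkew (s ∘ suc) e′ → Bounded (s ∘ suc) r c e′ →
    (∀ j → m ≤ j → c ≤ j → n j ≡ 0) →
    Σ Array λ e → IsSkew s e × Bounded s (suc r) c e ×
                  (∀ j → m ≤ j → firstRow s e j ≡ n j) × Agree (s ∘ suc) (rest s e) e′
  extraction-surjective {r} {c} {n} {e′} sk bd n-zero
    -- Diagonal `p` starts in column `p + m`, so it starts beyond the box as soon as `c ∸ m ≤ p`.
    -- The bound `c` itself would be too weak to return the column bound `c` for `e`.
    with insertion-surjective (c ∸ m) dec′ D′-zero (λ p le → n-zero _ (m≤n+m m p) (c≤ p le))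
    where
    c≤ : ∀ p → c ∸ m ≤ p → c ≤ p + m
    c≤ p le = ≤-trans (m≤n+m∸n c m) (subst (m + (c ∸ m) ≤_) (+-comm m p) (+-monoʳ-≤ m le))
    dec′ : Decreasing (diagonal m e′)
    dec′ p k =
      subst (λ c → e′ k c ≤ diagonal m e′ p k) (sym (+-suc k (p + m)))
        (right sk k _ (≤-trans (anti k) (in-region k p))) ,
      subst (λ c → diagonal m e′ p (suc k) ≤ e′ k c) (sym (+-suc k (p + m)))
        (down sk k _ (≤-trans (≤-trans (anti k) (in-region k p)) (n≤1+n _)))
    D′-zero : ∀ p → c ∸ m ≤ p → ∀ k → diagonal m e′ p k ≡ 0
    D′-zero p le k = bd k _ (≤-trans (anti k) (in-region k p)) (inj₂ (≤-trans (c≤ p le) (m≤n+m _ k)))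
  ... | D , I , decD , D′≺D , D-zero = e , sk-e , bd-e , row , rest≗
    where
    a : Array
    -- Row 0 west of the corner lies in the diagram, so this value is arbitrary.
    a zero    j = 0
    a (suc k) j = e′ k j
    e : Array
    e = paste m a D
    low : ∀ {k j} → j ≤ k + m → e (suc k) j ≡ e′ k j
    low le = paste-left m a D (s≤s le)
    high : ∀ p k → diagonal m e p k ≡ D p k
    high = paste-right m a D
    sk-e : IsSkew s e
    sk-e .right k j s≤j with side m k j
    ... | east p = subst₂ _≤_ (trans (sym (high (suc p) k)) (cong (e k) (+-suc k (p + m))))
                      (sym (high p k)) (proj₁ (decD p k))
    sk-e .right zero    j s≤j | west j<m = contradiction s≤j (<⇒≱ j<m)
    sk-e .right (suc k) j s≤j | west (s≤s j≤k+m) with m≤n⇒m<n∨m≡n j≤k+m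
    ... | inj₁ j<k+m = subst₂ _≤_ (sym (low j<k+m)) (sym (low j≤k+m)) (right sk k j s≤j)
    ... | inj₂ refl  = subst₂ _≤_ (sym (high 0 (suc k))) (sym (low ≤-refl)) (proj₂ (D′≺D 0 k))
    sk-e .down k j s≤j with side m k j
    ... | east zero    = subst₂ _≤_ (sym (low ≤-refl)) (sym (high 0 k)) (proj₁ (D′≺D 0 k))
    ... | east (suc p) = subst₂ _≤_ (trans (sym (high p (suc k))) (cong (e (suc k)) (sym (+-suc k (p + m)))))
                            (sym (high (suc p) k)) (proj₂ (decD p k))
    sk-e .down zero    j s≤j | west j<m = contradiction s≤j (<⇒≱ j<m)
    sk-e .down (suc k) j s≤j | west (s≤s j≤k+m) =
      subst₂ _≤_ (sym (low (≤-trans j≤k+m (n≤1+n _)))) (sym (low j≤k+m)) (down sk k j s≤j)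
    bd-e : Bounded s (suc r) c e
    bd-e k j s≤j b with side m k j
    bd-e zero    j s≤j b | west j<m = contradiction s≤j (<⇒≱ j<m)
    bd-e (suc k) j s≤j b | west (s≤s j≤k+m) =
      trans (low j≤k+m) (bd k j s≤j ([ inj₁ ∘ ≤-pred , inj₂ ]′ b))
    bd-e (suc k) j s≤j (inj₁ (s≤s r≤k)) | east p = n≤0⇒n≡0 (begin
      e (suc k) (suc (k + (p + m))) ≡⟨ high p (suc k) ⟩
      D p (suc k)                   ≤⟨ proj₂ (D′≺D p k) ⟩
      diagonal m e′ p k             ≡⟨ bd k _ (≤-trans (anti k) (in-region k p)) (inj₁ r≤k) ⟩
      0                             ∎)
      where open ≤-Reasoning
    -- The diagonals only control row 0 here; the lower rows follow because columns decrease.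
    bd-e k j s≤j (inj₂ c≤j) | east p = n≤0⇒n≡0 (begin
      e k j                 ≤⟨ column-≤ anti sk-e k m≤j ⟩
      e 0 j                 ≡⟨ cong (e 0) (m∸n+n≡m m≤j) ⟨
      e 0 (j ∸ m + m)       ≡⟨ high (j ∸ m) 0 ⟩
      D (j ∸ m) 0           ≡⟨ D-zero (j ∸ m) (∸-monoˡ-≤ m c≤j) 0 ⟩
      0                     ∎)
      where
      open ≤-Reasoning
      m≤j : m ≤ j
      m≤j = ≤-trans (m≤n+m m p) (m≤n+m _ k)
    diag-e : ∀ k → below m e k ≡ diagonal m e′ 0 k
    diag-e k = low ≤-refl
    row : ∀ j → m ≤ j → firstRow s e j ≡ n j
    row j m≤j = begin
      firstRow s e j                   ≡⟨ spill-cong diag-e high (j ∸ m) ⟩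
      spill (diagonal m e′ 0) D (j ∸ m) ≡⟨ insertion⇒spill I (j ∸ m) ⟨
      n (j ∸ m + m)                    ≡⟨ cong n (m∸n+n≡m m≤j) ⟩
      n j                              ∎
      where open ≡-Reasoning
    rest≗ : Agree (s ∘ suc) (rest s e) e′
    rest≗ k j s≤j with side m k j
    ... | west j<k+m = trans (rest-low s e (<⇒≤ j<k+m)) (low (<⇒≤ j<k+m))
    ... | east p    = trans (rest-high s e p k)
                       (trans (bump-cong diag-e high p k) (sym (insertion⇒bump I p k)))

-- Skew arrays as free arrays

params : (s : ℕ → ℕ) → Array → Array
params s e zero    = firstRow s e
params s e (suc i) = params (s ∘ suc) (rest s e) i

Bounded-mono : ∀ {s r r′ c c′ e} → r ≤ r′ → c ≤ c′ → Bounded s r c e → Bounded s r′ c′ e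
Bounded-mono r≤ c≤ bd i j s≤j b = bd i j s≤j
  ([ (λ le → inj₁ (≤-trans r≤ le)) , (λ le → inj₂ (≤-trans c≤ le)) ]′ b)

params-cong : ∀ {s e f} → Antitone s → Agree s e f → Agree s (params s e) (params s f)
params-cong anti e≗f zero    j s≤j = firstRow-cong anti e≗f j
params-cong anti e≗f (suc i) j s≤j = params-cong (anti ∘ suc) (rest-cong anti e≗f) i j s≤j

-- The box does not grow, because an extracted entry is at most the entry of row 0 above which it is
-- recorded and the remaining array fits in one row less.
params-bounded : ∀ {s r c e} → Antitone s → IsSkew s e → Bounded s r c e → Bounded s r c (params s e)
params-bounded anti sk bd zero    j s≤j b =
  n≤0⇒n≡0 (≤-trans (firstRow-≤ anti sk j s≤j) (≤-reflexive (bd 0 j s≤j b)))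
params-bounded {r = r} anti sk bd (suc i) j s≤j b =
  -- For `r` equal to 0 there is no smaller number of rows; `suc (pred r)` covers both cases.
  params-bounded {r = pred r} (anti ∘ suc) (rest-skew anti sk)
    (rest-bounded anti sk (Bounded-mono (m≤suc[pred] r) ≤-refl bd)) i j s≤j
    ([ inj₁ ∘ pred-mono-≤ , inj₂ ]′ b)
  where
  m≤suc[pred] : ∀ m → m ≤ suc (pred m)
  m≤suc[pred] zero    = z≤n
  m≤suc[pred] (suc m) = ≤-refl

params-injective : ∀ r {c s e f} → Antitone s → IsSkew s e → IsSkew s f →
  Bounded s r c e → Bounded s r c f → Agree s (params s e) (params s f) → Agree s e f
params-injective zero    anti ske skf bde bdf eq i j s≤j =
  trans (bde i j s≤j (inj₁ z≤n)) (sym (bdf i j s≤j (inj₁ z≤n)))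
params-injective (suc r) anti ske skf bde bdf eq =
  extraction-injective anti ske skf bde bdf (eq 0)
    (params-injective r (anti ∘ suc) (rest-skew anti ske) (rest-skew anti skf)
      (rest-bounded anti ske bde) (rest-bounded anti skf bdf) (eq ∘ suc))

params-surjective : ∀ r {c s n} → Antitone s → Bounded s r c n →
  Σ Array λ e → IsSkew s e × Bounded s r c e × Agree s (params s e) n
params-surjective zero {c} {s} anti bd =
  (λ _ _ → 0) , zero-skew , (λ _ _ _ _ → refl) ,
  λ i j s≤j → trans (params-bounded {r = 0} {c = c} anti zero-skew (λ _ _ _ _ → refl) i j s≤j (inj₁ z≤n))
                    (sym (bd i j s≤j (inj₁ z≤n)))
  where
  zero-skew : IsSkew s (λ _ _ → 0)
  zero-skew = record { down = λ _ _ _ → z≤n ; right = λ _ _ _ → z≤n }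
params-surjective (suc r) {s = s} {n} anti bd
  with params-surjective r (anti ∘ suc) (λ i j s≤j b → bd (suc i) j s≤j ([ inj₁ ∘ s≤s , inj₂ ]′ b))
... | e′ , sk′ , bd′ , eq′
  with extraction-surjective anti {n = n 0} sk′ bd′ (λ j s≤j c≤j → bd 0 j s≤j (inj₂ c≤j))
... | e , sk , bde , row , rest≗ = e , sk , bde , eq
  where
  eq : Agree s (params s e) n
  eq zero    j s≤j = row j s≤j
  eq (suc i) j s≤j = trans (params-cong (anti ∘ suc) rest≗ i j s≤j) (eq′ i j s≤j)

-- Weights

-- The indicator of `t ≤ j` as a number, so that legs of hooks can be written as sums.
ind : ℕ → ℕ → ℕ
ind zero    j       = 1
ind (suc t) zero    = 0
ind (suc t) (suc j) = ind t j

ind-≤ : ∀ {t j} → t ≤ j → ind t j ≡ 1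
ind-≤ z≤n       = refl
ind-≤ (s≤s t≤j) = ind-≤ t≤j

ind-> : ∀ {t j} → j < t → ind t j ≡ 0
ind-> {suc t} {zero}  _         = refl
ind-> {suc t} {suc j} (s≤s j<t) = ind-> j<t

-- The number of cells of the hook of (i , j) in the complement of the shape:
-- the arm runs left to the diagram and the leg runs up to it.
hook : (s : ℕ → ℕ) → ℕ → ℕ → ℕ
hook s i j = suc ((j ∸ s i) + S i (λ l → ind (s l) j))

rowSum : ℕ → (ℕ → ℕ) → ℕ → ℕ
rowSum c f m = S c (λ p → f (p + m))

weight : (s : ℕ → ℕ) (r c : ℕ) → Array → ℕ
weight s r c e = S r (λ i → rowSum c (e i) (s i))

infixl 7 _⊙_

_⊙_ : Array → Array → Array
(w ⊙ n) i j = w i j * n i j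

⊙-bounded : ∀ {s r c n} w → Bounded s r c n → Bounded s r c (w ⊙ n)
⊙-bounded w bd i j s≤j b = trans (cong (w i j *_) (bd i j s≤j b)) (*-zeroʳ (w i j))

tail-zero : ∀ {c m} (f : ℕ → ℕ) → (∀ j → m ≤ j → c ≤ j → f j ≡ 0) → VanishesFrom c (λ p → f (p + m))
tail-zero f z p c≤p = z _ (m≤n+m _ p) (≤-trans c≤p (m≤m+n p _))

rowSum-split : ∀ c f {m m′} → m ≤ m′ → (∀ j → m ≤ j → c ≤ j → f j ≡ 0) →
               rowSum c f m ≡ S (m′ ∸ m) (λ p → f (p + m)) + rowSum c f m′
rowSum-split c f {m} {m′} m≤m′ z =
  trans (S-splitAt (m′ ∸ m) c (λ p → f (p + m)) (tail-zero f z))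
    (cong (_ +_) (S-cong′ c λ p → cong f (trans (rearrange (m′ ∸ m) p m) (cong (p +_) (m∸n+n≡m m≤m′)))))
  where
  rearrange : ∀ x y z → x + y + z ≡ y + (x + z)
  rearrange = solve-∀

rowSum-ind : ∀ c f {m t} → m ≤ t → (∀ j → m ≤ j → c ≤ j → f j ≡ 0) →
             rowSum c (λ j → ind t j * f j) m ≡ rowSum c f t
rowSum-ind c f {m} {t} m≤t z = begin
  rowSum c g m                           ≡⟨ rowSum-split c g m≤t (λ j m≤j c≤j → trans (cong (ind t j *_) (z j m≤j c≤j)) (*-zeroʳ (ind t j))) ⟩
  S (t ∸ m) (λ p → g (p + m)) + rowSum c g t
    ≡⟨ cong₂ _+_ (S-zero (t ∸ m) λ p p<t∸m → cong (_* f (p + m)) (ind-> (below-t p p<t∸m)))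
                 (S-cong′ c λ p → trans (cong (_* f (p + t)) (ind-≤ (m≤n+m t p))) (+-identityʳ _)) ⟩
  rowSum c f t                           ∎
  where
  open ≡-Reasoning
  g : ℕ → ℕ
  g j = ind t j * f j
  below-t : ∀ p → p < t ∸ m → p + m < t
  below-t p lt = subst (p + m <_) (m∸n+n≡m m≤t) (+-monoˡ-< m lt)

module _ {s : ℕ → ℕ} (anti : Antitone s) {r c : ℕ} {e : Array}
         (sk : IsSkew s e) (bd : Bounded s (suc r) c e) where

  private
    m = s 0
    e′ = rest s e
    bd′ : Bounded (s ∘ suc) r c e′
    bd′ = rest-bounded anti sk bd

  diagonal-step : ∀ p → S (suc r) (diagonal m e p) ≡ rowSum c (firstRow s e) (p + m) + S r (diagonal m e′ p)
  diagonal-step p = begin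
    S (suc r) (diagonal m e p)
      ≡⟨ insertion-sum (suc r) c (rest-insertion anti sk) (diagonal-vanishes anti bd)
           (rest-diagonal-vanishes anti (Bounded-mono (n≤1+n r) ≤-refl bd′))
           (diagonal-zero anti bd) (rest-diagonal-zero anti bd′) p ⟩
    S c (λ q → firstRow s e (q + p + m)) + S (suc r) (diagonal m e′ p)
      ≡⟨ cong₂ _+_ (S-cong′ c λ q → cong (firstRow s e) (+-assoc q p m))
           (S-extend (diagonal m e′ p) (rest-diagonal-vanishes anti bd′ p) (n≤1+n r)) ⟩
    rowSum c (firstRow s e) (p + m) + S r (diagonal m e′ p) ∎
    where open ≡-Reasoning

  firstRow-tail : ∀ j → m ≤ j → c ≤ j → firstRow s e j ≡ 0
  firstRow-tail j m≤j c≤j = params-bounded anti sk bd 0 j m≤j (inj₂ c≤j)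

  weight-rest : weight (s ∘ suc) r c e′ ≡
    S r (λ k → S (k + m ∸ s (suc k)) (λ p → e′ k (p + s (suc k)))) + S c (λ p → S r (diagonal m e′ p))
  weight-rest = begin
    weight (s ∘ suc) r c e′
      ≡⟨ S-cong′ r (λ k → rowSum-split c (e′ k) (≤-trans (anti k) (in-region anti k 0)) (λ j s≤j c≤j → bd′ k j s≤j (inj₂ c≤j))) ⟩
    S r (λ k → A k + rowSum c (e′ k) (k + m))
      ≡⟨ S-+ r A (λ k → rowSum c (e′ k) (k + m)) ⟩
    S r A + S r (λ k → rowSum c (e′ k) (k + m))
      ≡⟨ cong (S r A +_) (S-cong′ r λ k → S-cong′ c λ p → cong (e′ k) (rearrange p k m)) ⟩
    S r A + S r (λ k → S c (λ p → diagonal m e′ p k))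
      ≡⟨ cong (S r A +_) (S-comm r c λ k p → diagonal m e′ p k) ⟩
    S r A + S c (λ p → S r (diagonal m e′ p)) ∎
    where
    open ≡-Reasoning
    A : ℕ → ℕ
    A k = S (k + m ∸ s (suc k)) (λ p → e′ k (p + s (suc k)))
    rearrange : ∀ x y z → x + (y + z) ≡ y + (x + z)
    rearrange = solve-∀

  weight-split : weight s (suc r) c e ≡
    S r (λ k → S (suc k + m ∸ s (suc k)) (λ p → e (suc k) (p + s (suc k)))) + S c (λ p → S (suc r) (diagonal m e p))
  weight-split = begin
    weight s (suc r) c e
      ≡⟨ S-cong′ (suc r) (λ k → rowSum-split c (e k) (in-region anti k 0) (λ j s≤j c≤j → bd k j s≤j (inj₂ c≤j))) ⟩
    S (suc r) (λ k → A k + rowSum c (e k) (k + m))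
      ≡⟨ S-+ (suc r) A (λ k → rowSum c (e k) (k + m)) ⟩
    S (suc r) A + S (suc r) (λ k → rowSum c (e k) (k + m))
      ≡⟨ cong₂ _+_ (cong (λ x → S x (λ p → e 0 (p + m)) + S r (A ∘ suc)) (n∸n≡0 m))
           (S-cong′ (suc r) λ k → S-cong′ c λ p → cong (e k) (rearrange p k m)) ⟩
    S r (A ∘ suc) + S (suc r) (λ k → S c (λ p → diagonal m e p k))
      ≡⟨ cong (S r (A ∘ suc) +_) (S-comm (suc r) c λ k p → diagonal m e p k) ⟩
    S r (A ∘ suc) + S c (λ p → S (suc r) (diagonal m e p)) ∎
    where
    open ≡-Reasoning
    A : ℕ → ℕ
    A k = S (k + m ∸ s k) (λ p → e k (p + s k))
    rearrange : ∀ x y z → x + (y + z) ≡ y + (x + z)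
    rearrange = solve-∀

  -- East of the corner, diagonal `p` of `e` exceeds that of `e′` by the tail of the first row from
  -- `p` on, and `S-tails` adds up these tails. West of it, row `suc k` of `e` continues one cell
  -- further than the western part of row `k` of `e′`; the extra entry is `e′ k (k + m)`, which the
  -- eastern part of `e′` contains already and which therefore appears separately.
  weight-step : weight s (suc r) c e ≡
    S c (λ q → suc q * firstRow s e (q + m)) + (S r (λ k → e′ k (k + m)) + weight (s ∘ suc) r c e′)
  weight-step = begin
    weight s (suc r) c e
      ≡⟨ weight-split ⟩
    S r (λ k → S (suc k + m ∸ s (suc k)) (λ p → e (suc k) (p + s (suc k)))) + S c (λ p → S (suc r) (diagonal m e p))
      ≡⟨ cong₂ _+_ (S-cong′ r row) (S-cong′ c diagonal-step) ⟩
    S r (λ k → A k + e′ k (k + m)) + S c (λ p → rowSum c (firstRow s e) (p + m) + S r (diagonal m e′ p))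
      ≡⟨ cong₂ _+_ (S-+ r A (λ k → e′ k (k + m)))
                   (S-+ c (λ p → rowSum c (firstRow s e) (p + m)) (λ p → S r (diagonal m e′ p))) ⟩
    S r A + S r (λ k → e′ k (k + m)) + (S c (λ p → rowSum c (firstRow s e) (p + m)) + S c (λ p → S r (diagonal m e′ p)))
      ≡⟨ cong (λ x → S r A + S r (λ k → e′ k (k + m)) + (x + S c (λ p → S r (diagonal m e′ p))))
           (trans (S-cong′ c λ p → S-cong′ c λ q → cong (firstRow s e) (sym (+-assoc q p m)))
                  (S-tails c (λ q → firstRow s e (q + m)) (tail-zero (firstRow s e) firstRow-tail))) ⟩
    S r A + S r (λ k → e′ k (k + m)) + (F + S c (λ p → S r (diagonal m e′ p)))
      ≡⟨ rearrange (S r A) _ F _ ⟩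
    F + (S r (λ k → e′ k (k + m)) + (S r A + S c (λ p → S r (diagonal m e′ p))))
      ≡⟨ cong (λ x → F + (S r (λ k → e′ k (k + m)) + x)) (sym weight-rest) ⟩
    F + (S r (λ k → e′ k (k + m)) + weight (s ∘ suc) r c e′) ∎
    where
    open ≡-Reasoning
    F = S c (λ q → suc q * firstRow s e (q + m))
    A : ℕ → ℕ
    A k = S (k + m ∸ s (suc k)) (λ p → e′ k (p + s (suc k)))
    rearrange : ∀ w x y z → w + x + (y + z) ≡ y + (x + (w + z))
    rearrange = solve-∀
    row : ∀ k → S (suc k + m ∸ s (suc k)) (λ p → e (suc k) (p + s (suc k))) ≡ A k + e′ k (k + m)
    row k = begin
      S (suc k + m ∸ s (suc k)) f  ≡⟨ cong (λ x → S x f) (+-∸-assoc 1 s≤) ⟩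
      S (suc ℓ) f                  ≡⟨ S-last ℓ f ⟩
      S ℓ f + f ℓ                  ≡⟨ cong₂ _+_ (S-cong ℓ λ p p<ℓ → sym (rest-low s e (low p (<⇒≤ p<ℓ))))
                                       (sym (trans (rest-low s e ≤-refl) (cong (e (suc k)) (sym (m∸n+n≡m s≤))))) ⟩
      A k + e′ k (k + m)           ∎
      where
      s≤ : s (suc k) ≤ k + m
      s≤ = ≤-trans (anti k) (in-region anti k 0)
      ℓ = k + m ∸ s (suc k)
      f : ℕ → ℕ
      f p = e (suc k) (p + s (suc k))
      low : ∀ p → p ≤ ℓ → p + s (suc k) ≤ k + m
      low p p≤ℓ = subst (p + s (suc k) ≤_) (m∸n+n≡m s≤) (+-monoˡ-≤ (s (suc k)) p≤ℓ)

-- Because `s 0 ≤ t`, the diagonal through column `t` of row 0 stays in the toggled region for all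
-- later shapes too. Each extraction takes from it the extracted row from column `t` on.
diagonal-sum : ∀ r {c s e} → Antitone s → IsSkew s e → Bounded s r c e → ∀ t → s 0 ≤ t →
  S r (λ k → e k (k + t)) ≡ weight s r c ((λ _ → ind t) ⊙ params s e)
diagonal-sum zero anti sk bd t s₀≤t = refl
diagonal-sum (suc r) {c} {s} {e} anti sk bd t s₀≤t = begin
  S (suc r) (λ k → e k (k + t))
    ≡⟨ S-cong′ (suc r) (λ k → cong (λ x → e k (k + x)) (sym (m∸n+n≡m s₀≤t))) ⟩
  S (suc r) (diagonal (s 0) e (t ∸ s 0))
    ≡⟨ diagonal-step anti sk bd (t ∸ s 0) ⟩
  rowSum c (firstRow s e) (t ∸ s 0 + s 0) + S r (diagonal (s 0) (rest s e) (t ∸ s 0))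
    ≡⟨ cong (λ x → rowSum c (firstRow s e) x + S r (λ k → rest s e k (k + x))) (m∸n+n≡m s₀≤t) ⟩
  rowSum c (firstRow s e) t + S r (λ k → rest s e k (k + t))
    ≡⟨ cong₂ _+_ (sym (rowSum-ind c (firstRow s e) s₀≤t (firstRow-tail anti sk bd)))
         (diagonal-sum r (anti ∘ suc) (rest-skew anti sk) (rest-bounded anti sk bd) t (≤-trans (anti 0) s₀≤t)) ⟩
  weight s (suc r) c ((λ _ → ind t) ⊙ params s e) ∎
  where open ≡-Reasoning

weight-+ : ∀ s r c e f → weight s r c (λ i j → e i j + f i j) ≡ weight s r c e + weight s r c f
weight-+ s r c e f = trans (S-cong′ r λ i → S-+ c (λ p → e i (p + s i)) (λ p → f i (p + s i)))
  (S-+ r (λ i → rowSum c (e i) (s i)) (λ i → rowSum c (f i) (s i)))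

-- In row 0 the leg is empty and the factor `suc q` of `weight-step` is the whole hook. For a lower
-- cell, putting row 0 back adds a leg cell exactly when its column is at least `s 0`;
-- `diagonal-sum` at `t = s 0` shows that the separate diagonal in `weight-step` contributes
-- precisely this.
weight-params : ∀ r {c s e} → Antitone s → IsSkew s e → Bounded s r c e →
  weight s r c e ≡ weight s r c (hook s ⊙ params s e)
weight-params zero anti sk bd = refl
weight-params (suc r) {c} {s} {e} anti sk bd = begin
  weight s (suc r) c e
    ≡⟨ weight-step anti sk bd ⟩
  S c (λ q → suc q * firstRow s e (q + s 0)) + (S r (λ k → rest s e k (k + s 0)) + weight s′ r c (rest s e))
    ≡⟨ cong₂ _+_ (S-cong′ c λ q → cong (_* firstRow s e (q + s 0)) (cong suc (trans (sym (m+n∸n≡m q (s 0))) (sym (+-identityʳ _)))))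
        (cong₂ _+_ (diagonal-sum r (anti ∘ suc) sk′ bd′ (s 0) (anti 0)) (weight-params r (anti ∘ suc) sk′ bd′)) ⟩
  rowSum c ((hook s ⊙ params s e) 0) (s 0) + (weight s′ r c ((λ _ → ind (s 0)) ⊙ n′) + weight s′ r c (hook s′ ⊙ n′))
    ≡⟨ cong (rowSum c ((hook s ⊙ params s e) 0) (s 0) +_)
         (trans (sym (weight-+ s′ r c ((λ _ → ind (s 0)) ⊙ n′) (hook s′ ⊙ n′)))
           (S-cong′ r λ i → S-cong′ c λ p → factor (p + s′ i ∸ s′ i) (ind (s 0) (p + s′ i)) (S i (λ l → ind (s′ l) (p + s′ i))) (n′ i (p + s′ i)))) ⟩
  weight s (suc r) c (hook s ⊙ params s e) ∎
  where
  open ≡-Reasoning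
  s′ = s ∘ suc
  n′ = params s′ (rest s e)
  sk′ = rest-skew anti sk
  bd′ = rest-bounded anti sk bd
  factor : ∀ a x b n → x * n + suc (a + b) * n ≡ suc (a + (x + b)) * n
  factor = solve-∀

-- Reading the boundary of a diagram

-- Follow the boundary of a diagram s with L rows inside m columns, starting in
-- the upper right corner.  vdist and hdist give the positions of its vertical
-- step in row i and of its horizontal step in column j; together they
-- enumerate ℕ without repetition.

vdist : ℕ → (ℕ → ℕ) → ℕ → ℕ
vdist m s i = (m ∸ s i) + i

hdist : ℕ → ℕ → (ℕ → ℕ) → ℕ → ℕ
hdist L m s j = (m ∸ suc j) + S L (λ l → ind (suc j) (s l))

-- The boundary path as an inductive view, so that statements about step positions follow by peeling
-- off the first step. After `stop` all remaining steps are vertical.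
data Boundary : ℕ → ℕ → (ℕ → ℕ) → Set where
  stop       : ∀ {s} → (∀ i → s i ≡ 0) → Boundary 0 0 s
  vertical   : ∀ {L m s} → s 0 ≡ m → Boundary L m (s ∘ suc) → Boundary (suc L) m s
  horizontal : ∀ {L m s} → (∀ i → s i ≤ m) → Boundary L m s → Boundary L (suc m) s

boundary : ∀ L m {s} → Antitone s → s 0 ≤ m → VanishesFrom L s → Boundary L m s
boundary zero    zero    anti s₀≤m s-zero = stop λ i → s-zero i z≤n
boundary (suc L) zero    anti s₀≤m s-zero = vertical (n≤0⇒n≡0 s₀≤m)
  (boundary L zero (anti ∘ suc) (≤-trans (anti 0) s₀≤m) (λ i le → s-zero (suc i) (s≤s le)))
boundary L (suc m) {s} anti s₀≤m s-zero with s 0 ≤? m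
boundary L (suc m) {s} anti s₀≤m s-zero | yes s₀≤m′ =
  horizontal (λ i → ≤-trans (antitone₀ anti i) s₀≤m′) (boundary L m anti s₀≤m′ s-zero)
boundary zero    (suc m) {s} anti s₀≤m s-zero | no s₀≰m =
  contradiction (subst (_≤ m) (sym (s-zero 0 z≤n)) z≤n) s₀≰m
boundary (suc L) (suc m) {s} anti s₀≤m s-zero | no s₀≰m =
  vertical (≤-antisym s₀≤m (≰⇒> s₀≰m))
    (boundary L (suc m) (anti ∘ suc) (≤-trans (anti 0) s₀≤m) (λ i le → s-zero (suc i) (s≤s le)))

module _ {m : ℕ} {s : ℕ → ℕ} where

  vdist-stop : (∀ i → s i ≡ 0) → ∀ i → vdist 0 s i ≡ i
  vdist-stop s≗0 i = cong (_+ i) (0∸n≡0 (s i))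

  vdist-vertical₀ : s 0 ≡ m → vdist m s 0 ≡ 0
  vdist-vertical₀ refl = trans (+-identityʳ _) (n∸n≡0 m)

  vdist-vertical : ∀ i → vdist m s (suc i) ≡ suc (vdist m (s ∘ suc) i)
  vdist-vertical i = +-suc _ i

  hdist-vertical : ∀ L {j} → s 0 ≡ m → j < m → hdist (suc L) m s j ≡ suc (hdist L m (s ∘ suc) j)
  hdist-vertical L {j} refl j<m =
    trans (cong (λ x → (m ∸ suc j) + (x + S L (λ l → ind (suc j) (s (suc l))))) (ind-≤ j<m)) (+-suc _ _)

  vdist-horizontal : (∀ i → s i ≤ m) → ∀ i → vdist (suc m) s i ≡ suc (vdist m s i)
  vdist-horizontal s≤m i = cong (_+ i) (+-∸-assoc 1 (s≤m i))

  hdist-horizontal₀ : (∀ i → s i ≤ m) → ∀ L → hdist L (suc m) s m ≡ 0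
  hdist-horizontal₀ s≤m L = cong₂ _+_ (n∸n≡0 m) (S-zero L λ l _ → ind-> (s≤s (s≤m l)))

  hdist-horizontal : ∀ L {j} → j < m → hdist L (suc m) s j ≡ suc (hdist L m s j)
  hdist-horizontal L {j} j<m = cong (_+ S L (λ l → ind (suc j) (s l))) (m∸j j<m)
    where
    m∸j : j < m → m ∸ j ≡ suc (m ∸ suc j)
    m∸j j<m = +-∸-assoc 1 j<m

-- This is surjectivity of the step positions onto ℕ, put as an extensionality principle so that no
-- function from positions back to steps has to be defined.
boundary-cover : ∀ {L m s} → Boundary L m s → ∀ {g h : ℕ → ℕ} →
  (∀ i → g (vdist m s i) ≡ h (vdist m s i)) → (∀ j → j < m → g (hdist L m s j) ≡ h (hdist L m s j)) →
  ∀ q → g q ≡ h q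
boundary-cover (stop s≗0) {g} {h} v≗ h≗ q = subst (λ x → g x ≡ h x) (vdist-stop {0} s≗0 q) (v≗ q)
boundary-cover (vertical {L} {s = s} s₀≡m b) {g} {h} v≗ h≗ zero =
  subst (λ x → g x ≡ h x) (vdist-vertical₀ {s = s} s₀≡m) (v≗ 0)
boundary-cover (vertical {L} {s = s} s₀≡m b) {g} {h} v≗ h≗ (suc q) = boundary-cover b {g ∘ suc} {h ∘ suc}
  (λ i → subst (λ x → g x ≡ h x) (vdist-vertical {s = s} i) (v≗ (suc i)))
  (λ j j<m → subst (λ x → g x ≡ h x) (hdist-vertical {s = s} L s₀≡m j<m) (h≗ j j<m)) q
boundary-cover (horizontal {L} {m} s≤m b) {g} {h} v≗ h≗ zero =
  subst (λ x → g x ≡ h x) (hdist-horizontal₀ s≤m L) (h≗ m ≤-refl)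
boundary-cover (horizontal {L} {s = s} s≤m b) {g} {h} v≗ h≗ (suc q) = boundary-cover b {g ∘ suc} {h ∘ suc}
  (λ i → subst (λ x → g x ≡ h x) (vdist-horizontal s≤m i) (v≗ i))
  (λ j j<m → subst (λ x → g x ≡ h x) (hdist-horizontal {s = s} L j<m) (h≗ j (m≤n⇒m≤1+n j<m))) q

cons : ℕ → (ℕ → ℕ) → ℕ → ℕ
cons x g zero    = x
cons x g (suc q) = g q

boundary-fill : ∀ {L m s} → Boundary L m s → ∀ {n} {a b : ℕ → ℕ} → VanishesFrom n a →
  Σ (ℕ → ℕ) λ g → ∃ (λ n′ → VanishesFrom n′ g) ×
    (∀ i → g (vdist m s i) ≡ a i) × (∀ j → j < m → g (hdist L m s j) ≡ b j)
boundary-fill (stop s≗0) {n} {a} va = a , (n , va) , (λ i → cong a (vdist-stop {0} s≗0 i)) , λ _ ()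
boundary-fill (vertical {L} {m} {s} s₀≡m bd) {n} {a} {b} va
  with boundary-fill bd {n} {a ∘ suc} {b} (λ i le → va (suc i) (m≤n⇒m≤1+n le))
... | g , (n′ , vg) , gv , gh =
  cons (a 0) g , (suc n′ , λ { (suc i) (s≤s le) → vg i le }) ,
  (λ { zero → cong (cons (a 0) g) (vdist-vertical₀ {s = s} s₀≡m)
     ; (suc i) → trans (cong (cons (a 0) g) (vdist-vertical {s = s} i)) (gv i) }) ,
  λ j j<m → trans (cong (cons (a 0) g) (hdist-vertical {s = s} L s₀≡m j<m)) (gh j j<m)
boundary-fill (horizontal {L} {m} {s} s≤m bd) {n} {a} {b} va with boundary-fill bd {n} {a} {b} va
... | g , (n′ , vg) , gv , gh =
  cons (b m) g , (suc n′ , λ { (suc i) (s≤s le) → vg i le }) ,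
  (λ i → trans (cong (cons (b m) g) (vdist-horizontal s≤m i)) (gv i)) , gh′
  where
  gh′ : ∀ j → j < suc m → cons (b m) g (hdist L (suc m) s j) ≡ b j
  gh′ j (s≤s j≤m) with m≤n⇒m<n∨m≡n j≤m
  ... | inj₁ j<m  = trans (cong (cons (b m) g) (hdist-horizontal {s = s} L j<m)) (gh j j<m)
  ... | inj₂ refl = cong (cons (b m) g) (hdist-horizontal₀ s≤m L)

boundary-sum : ∀ {L m s} → Boundary L m s → ∀ n f → VanishesFrom n f →
               S n f ≡ S n (f ∘ vdist m s) + S m (f ∘ hdist L m s)
boundary-sum (stop s≗0) n f vf =
  sym (trans (+-identityʳ _) (S-cong′ n λ i → cong f (vdist-stop {0} s≗0 i)))
boundary-sum (vertical {L} {m} {s} s₀≡m b) n f vf = begin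
  S n f ≡⟨ S-extend f vf (n≤1+n n) ⟨
  f 0 + S n (f ∘ suc)
    ≡⟨ cong (f 0 +_) (boundary-sum b n (f ∘ suc) (λ i le → vf (suc i) (m≤n⇒m≤1+n le))) ⟩
  f 0 + (S n (f ∘ suc ∘ vdist m (s ∘ suc)) + S m (f ∘ suc ∘ hdist L m (s ∘ suc)))
    ≡⟨ +-assoc (f 0) _ _ ⟨
  f 0 + S n (f ∘ suc ∘ vdist m (s ∘ suc)) + S m (f ∘ suc ∘ hdist L m (s ∘ suc))
    ≡⟨ cong₂ _+_ (cong₂ _+_ (cong f (sym (vdist-vertical₀ {s = s} s₀≡m))) (S-cong′ n λ i → cong f (sym (vdist-vertical {s = s} i))))
                 (S-cong m λ j j<m → cong f (sym (hdist-vertical {s = s} L s₀≡m j<m))) ⟩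
  S (suc n) (f ∘ vdist m s) + S m (f ∘ hdist (suc L) m s)
    ≡⟨ cong (_+ S m (f ∘ hdist (suc L) m s)) (S-extend (f ∘ vdist m s) (λ i le → vf _ (≤-trans le (m≤n+m i _))) (n≤1+n n)) ⟩
  S n (f ∘ vdist m s) + S m (f ∘ hdist (suc L) m s) ∎
  where open ≡-Reasoning
boundary-sum (horizontal {L} {m} {s} s≤m b) n f vf = begin
  S n f ≡⟨ S-extend f vf (n≤1+n n) ⟨
  f 0 + S n (f ∘ suc)
    ≡⟨ cong (f 0 +_) (boundary-sum b n (f ∘ suc) (λ i le → vf (suc i) (m≤n⇒m≤1+n le))) ⟩
  f 0 + (S n (f ∘ suc ∘ vdist m s) + S m (f ∘ suc ∘ hdist L m s))
    ≡⟨ rearrange (f 0) (S n (f ∘ suc ∘ vdist m s)) (S m (f ∘ suc ∘ hdist L m s)) ⟩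
  S n (f ∘ suc ∘ vdist m s) + (S m (f ∘ suc ∘ hdist L m s) + f 0)
    ≡⟨ cong₂ _+_ (S-cong′ n λ i → cong f (sym (vdist-horizontal s≤m i)))
        (cong₂ _+_ (S-cong m λ j j<m → cong f (sym (hdist-horizontal {s = s} L j<m))) (cong f (sym (hdist-horizontal₀ s≤m L)))) ⟩
  S n (f ∘ vdist (suc m) s) + (S m (f ∘ hdist L (suc m) s) + f (hdist L (suc m) s m))
    ≡⟨ cong (S n (f ∘ vdist (suc m) s) +_) (S-last m (f ∘ hdist L (suc m) s)) ⟨
  S n (f ∘ vdist (suc m) s) + S (suc m) (f ∘ hdist L (suc m) s) ∎
  where
  open ≡-Reasoning
  rearrange : ∀ x y z → x + (y + z) ≡ y + (z + x)
  rearrange = solve-∀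

-- Moving the cells outside a diagram

insertAt : ℕ → ℕ → (ℕ → ℕ) → ℕ → ℕ
insertAt zero    x f zero    = x
insertAt zero    x f (suc j) = f j
insertAt (suc m) x f zero    = f 0
insertAt (suc m) x f (suc j) = insertAt m x (f ∘ suc) j

insertAt-< : ∀ {m x f j} → j < m → insertAt m x f j ≡ f j
insertAt-< {suc m} {j = zero}  _         = refl
insertAt-< {suc m} {f = f} {suc j} (s≤s j<m) = insertAt-< {m} {f = f ∘ suc} j<m

insertAt-≡ : ∀ m {x f} → insertAt m x f m ≡ x
insertAt-≡ zero        = refl
insertAt-≡ (suc m) {f = f} = insertAt-≡ m {f = f ∘ suc}

insertAt-> : ∀ {m x f j} → m ≤ j → insertAt m x f (suc j) ≡ f j
insertAt-> {zero}                  _         = refl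
insertAt-> {suc m} {f = f} {suc j} (s≤s m≤j) = insertAt-> {m} {f = f ∘ suc} m≤j

data Position (m : ℕ) : ℕ → Set where
  before : ∀ {j} → j < m → Position m j
  at     : Position m m
  after  : ∀ {j} → m ≤ j → Position m (suc j)

position : ∀ m j → Position m j
position m j with <-cmp j m
position m j       | tri< j<m _ _       = before j<m
position m j       | tri≈ _ refl _      = at
position m (suc j) | tri> _ _ (s≤s m≤j) = after m≤j

rowSum-insertAt : ∀ c {m x f t} → t ≤ m → (∀ j → t ≤ j → c ≤ j → f j ≡ 0) →
  (∀ j → t ≤ j → suc c ≤ j → insertAt m x f j ≡ 0) →
  rowSum (suc c) (insertAt m x f) t ≡ x + rowSum c f t
rowSum-insertAt c {m} {x} {f} {t} t≤m zf zi = begin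
  rowSum (suc c) g t
    ≡⟨ rowSum-split (suc c) g t≤m zi ⟩
  S (m ∸ t) (λ p → g (p + t)) + (g m + rowSum c (g ∘ suc) m)
    ≡⟨ cong₂ _+_ (S-cong (m ∸ t) λ p p< → insertAt-< (subst (p + t <_) (m∸n+n≡m t≤m) (+-monoˡ-< t p<)))
        (cong₂ _+_ (insertAt-≡ m) (S-cong′ c λ p → insertAt-> (m≤n+m m p))) ⟩
  S (m ∸ t) (λ p → f (p + t)) + (x + rowSum c f m)
    ≡⟨ rearrange (S (m ∸ t) (λ p → f (p + t))) x (rowSum c f m) ⟩
  x + (S (m ∸ t) (λ p → f (p + t)) + rowSum c f m)
    ≡⟨ cong (x +_) (rowSum-split c f t≤m zf) ⟨
  x + rowSum c f t ∎
  where
  open ≡-Reasoning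
  g = insertAt m x f
  rearrange : ∀ x y z → x + (y + z) ≡ y + (x + z)
  rearrange = solve-∀

-- The first row outside s is distributed along the boundary of the diagram
-- below the first row: vertical steps feed a new column s 0 of the smaller
-- shape, horizontal steps the first row inside the diagram.

transfer : (s : ℕ → ℕ) → Array → Array
transfer s n i = insertAt (s 0) (n 0 (vdist (s 0) (s ∘ suc) i + s 0)) (n (suc i))

edge : ℕ → (s : ℕ → ℕ) → Array → ℕ → ℕ
edge L s n j = n 0 (hdist L (s 0) (s ∘ suc) j + s 0)

inner : ℕ → (s : ℕ → ℕ) → Array → Array
inner zero    s n i       = const 0
inner (suc L) s n zero    = edge L s n
inner (suc L) s n (suc i) = inner L (s ∘ suc) (transfer s n) i

outer : ℕ → (s : ℕ → ℕ) → Array → Array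
outer zero    s n = n
outer (suc L) s n = outer L (s ∘ suc) (transfer s n)

AgreeInside : (s : ℕ → ℕ) → Array → Array → Set
AgreeInside s e f = ∀ i j → j < s i → e i j ≡ f i j

hookInside : ℕ → (s : ℕ → ℕ) → ℕ → ℕ → ℕ
hookInside L s i j = suc ((s i ∸ suc j) + S (L ∸ suc i) (λ l → ind (suc j) (s (suc i + l))))

weightInside : ℕ → (s : ℕ → ℕ) → Array → ℕ
weightInside L s e = S L (λ i → S (s i) (e i))

module _ {s : ℕ → ℕ} (anti : Antitone s) where

  private m = s 0

  transfer-cong : ∀ {e f} → Agree s e f → Agree (s ∘ suc) (transfer s e) (transfer s f)
  transfer-cong {e} {f} e≗f i j s≤j with position m j
  ... | before j<m = trans (insertAt-< j<m) (trans (e≗f (suc i) j s≤j) (sym (insertAt-< j<m)))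
  ... | at         = trans (insertAt-≡ m) (trans (e≗f 0 _ (m≤n+m m _)) (sym (insertAt-≡ m)))
  ... | after {j} m≤j = trans (insertAt-> m≤j)
    (trans (e≗f (suc i) j (≤-trans (antitone₀ anti (suc i)) m≤j)) (sym (insertAt-> m≤j)))

  transfer-bounded : ∀ {b n} → Bounded s b b n → Bounded (s ∘ suc) b (suc b) (transfer s n)
  transfer-bounded {b} {n} bd i j s≤j w with position m j
  ... | before j<m    = trans (insertAt-< j<m) (bd (suc i) j s≤j ([ inj₁ ∘ m≤n⇒m≤1+n , inj₂ ∘ <⇒≤ ]′ w))
  ... | at            = trans (insertAt-≡ m) (bd 0 _ (m≤n+m m _) (inj₂
    ([ (λ b≤i → ≤-trans b≤i (≤-trans (m≤n+m i _) (m≤m+n _ m))) , (λ b<m → ≤-trans (<⇒≤ b<m) (m≤n+m m _)) ]′ w)))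
  ... | after {j} m≤j = trans (insertAt-> m≤j) (bd (suc i) j (≤-trans (antitone₀ anti (suc i)) m≤j)
    ([ inj₁ ∘ m≤n⇒m≤1+n , inj₂ ∘ ≤-pred ]′ w))

  legs : ∀ i {j} → m ≤ j → S i (λ l → ind (s (suc l)) j) ≡ i
  legs i {j} m≤j = trans (S-cong′ i λ l → ind-≤ (≤-trans (antitone₀ anti (suc l)) m≤j)) (ones i)
    where
    ones : ∀ i → S i (const 1) ≡ i
    ones zero    = refl
    ones (suc i) = cong suc (ones i)

  transfer-hook : ∀ n i j → s (suc i) ≤ j → (hook (s ∘ suc) ⊙ transfer s n) i j ≡
    insertAt m (suc (vdist m (s ∘ suc) i) * n 0 (vdist m (s ∘ suc) i + m)) ((hook s ⊙ n) (suc i)) j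
  transfer-hook n i j s≤j with position m j
  ... | before j<m = trans
    (cong₂ _*_ (cong (λ x → suc ((j ∸ s (suc i)) + (x + S i (λ l → ind (s (suc l)) j)))) (sym (ind-> j<m)))
               (insertAt-< j<m))
    (sym (insertAt-< j<m))
  ... | at = trans (cong₂ (λ x y → suc ((m ∸ s (suc i)) + x) * y) (legs i ≤-refl) (insertAt-≡ m)) (sym (insertAt-≡ m))
  ... | after {j} m≤j = trans (cong₂ _*_ (cong suc arms) (insertAt-> m≤j)) (sym (insertAt-> m≤j))
    where
    open ≡-Reasoning
    arms : (suc j ∸ s (suc i)) + S i (λ l → ind (s (suc l)) (suc j)) ≡
           (j ∸ s (suc i)) + (ind m j + S i (λ l → ind (s (suc l)) j))
    arms = begin
      (suc j ∸ s (suc i)) + S i (λ l → ind (s (suc l)) (suc j))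
        ≡⟨ cong₂ _+_ (+-∸-assoc 1 (≤-trans (antitone₀ anti (suc i)) m≤j)) (legs i (m≤n⇒m≤1+n m≤j)) ⟩
      suc (j ∸ s (suc i)) + i
        ≡⟨ +-suc (j ∸ s (suc i)) i ⟨
      (j ∸ s (suc i)) + suc i
        ≡⟨ cong ((j ∸ s (suc i)) +_) (cong₂ _+_ (ind-≤ m≤j) (legs i m≤j)) ⟨
      (j ∸ s (suc i)) + (ind m j + S i (λ l → ind (s (suc l)) j)) ∎

  module _ {L : ℕ} (s-zero : VanishesFrom (suc L) s) where

    private
      path : Boundary L m (s ∘ suc)
      path = boundary L m (anti ∘ suc) (anti 0) (λ i le → s-zero (suc i) (s≤s le))

    transfer-injective : ∀ {e f} → (∀ j → j < m → edge L s e j ≡ edge L s f j) →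
      Agree (s ∘ suc) (transfer s e) (transfer s f) → Agree s e f
    transfer-injective {e} {f} edge≗ t≗ zero j m≤j =
      subst (λ x → e 0 x ≡ f 0 x) (m∸n+n≡m m≤j) (boundary-cover path {λ q → e 0 (q + m)} {λ q → f 0 (q + m)}
        (λ i → trans (sym (insertAt-≡ m)) (trans (t≗ i m (antitone₀ anti (suc i))) (insertAt-≡ m))) edge≗ (j ∸ m))
    transfer-injective {e} {f} edge≗ t≗ (suc i) j s≤j with <-≤-connex j m
    ... | inj₁ j<m = trans (sym (insertAt-< j<m)) (trans (t≗ i j s≤j) (insertAt-< j<m))
    ... | inj₂ m≤j = trans (sym (insertAt-> m≤j)) (trans (t≗ i (suc j) (m≤n⇒m≤1+n s≤j)) (insertAt-> m≤j))

    transfer-surjective : ∀ {b} {x : ℕ → ℕ} {e′} → Bounded (s ∘ suc) b b e′ →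
      Σ Array λ e → ∃ (λ b′ → Bounded s b′ b′ e) ×
        (∀ j → j < m → edge L s e j ≡ x j) × Agree (s ∘ suc) (transfer s e) e′
    transfer-surjective {b} {x} {e′} bd
      with boundary-fill path {b} {λ i → e′ i m} {x} (λ i le → bd i m (antitone₀ anti (suc i)) (inj₁ le))
    ... | g , (n , vg) , gv , gh = e , (b′ , bd-e) , (λ j j<m → trans (cong g (m+n∸n≡m _ m)) (gh j j<m)) , t≗
      where
      e : Array
      e zero    j = g (j ∸ m)
      e (suc i) j with j <? m
      ... | yes _ = e′ i j
      ... | no  _ = e′ i (suc j)
      e-< : ∀ i {j} → j < m → e (suc i) j ≡ e′ i j
      e-< i {j} j<m with j <? m
      ... | yes _   = refl
      ... | no  j≮m = contradiction j<m j≮m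
      e-≥ : ∀ i {j} → m ≤ j → e (suc i) j ≡ e′ i (suc j)
      e-≥ i {j} m≤j with j <? m
      ... | yes j<m = contradiction j<m (≤⇒≯ m≤j)
      ... | no  _   = refl
      b′ = suc (b + (n + m))
      b≤b′ : b ≤ b′
      b≤b′ = ≤-trans (m≤m+n b (n + m)) (n≤1+n _)
      bd-e : Bounded s b′ b′ e
      bd-e zero    j m≤j (inj₂ b′≤j) = vg _ (subst (_≤ j ∸ m) (m+n∸n≡m n m)
        (∸-monoˡ-≤ m (≤-trans (≤-trans (m≤n+m (n + m) b) (n≤1+n _)) b′≤j)))
      bd-e (suc i) j s≤j w with <-≤-connex j m
      ... | inj₁ j<m = trans (e-< i j<m) (bd i j s≤j
        ([ (λ le → inj₁ (≤-trans (m≤m+n b (n + m)) (≤-pred le))) , inj₂ ∘ ≤-trans b≤b′ ]′ w))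
      ... | inj₂ m≤j = trans (e-≥ i m≤j) (bd i (suc j) (m≤n⇒m≤1+n s≤j)
        ([ (λ le → inj₁ (≤-trans (m≤m+n b (n + m)) (≤-pred le))) , (λ le → inj₂ (m≤n⇒m≤1+n (≤-trans b≤b′ le))) ]′ w))
      t≗ : Agree (s ∘ suc) (transfer s e) e′
      t≗ i j s≤j with position m j
      ... | before j<m    = trans (insertAt-< j<m) (e-< i j<m)
      ... | at            = trans (insertAt-≡ m) (trans (cong g (m+n∸n≡m _ m)) (gv i))
      ... | after {j} m≤j = trans (insertAt-> m≤j) (e-≥ i m≤j)

    transfer-weight : ∀ {b n} → Bounded s b b n →
      weight s (suc b) b (hook s ⊙ n) ≡
      S m (λ j → hookInside (suc L) s 0 j * edge L s n j) + weight (s ∘ suc) b (suc b) (hook (s ∘ suc) ⊙ transfer s n)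
    transfer-weight {b} {n} bd = begin
      rowSum b ((hook s ⊙ n) 0) m + S b (λ i → R i)
        ≡⟨ cong (_+ S b R) (S-cong′ b λ p → cong (λ x → suc x * n 0 (p + m)) (trans (+-identityʳ _) (m+n∸n≡m p m))) ⟩
      S b f + S b R
        ≡⟨ cong (_+ S b R) (boundary-sum path b f (λ p b≤p → trans (cong (suc p *_)
             (bd 0 _ (m≤n+m m p) (inj₂ (≤-trans b≤p (m≤m+n p m))))) (*-zeroʳ (suc p)))) ⟩
      S b V + H + S b R
        ≡⟨ rearrange (S b V) H (S b R) ⟩
      H + (S b V + S b R)
        ≡⟨ cong (H +_) (S-+ b V R) ⟨
      H + S b (λ i → V i + R i)
        ≡⟨ cong (H +_) (S-cong′ b λ i → sym (row i)) ⟩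
      H + weight (s ∘ suc) b (suc b) (hook (s ∘ suc) ⊙ transfer s n) ∎
      where
      open ≡-Reasoning
      f V R : ℕ → ℕ
      f q = suc q * n 0 (q + m)
      V i = f (vdist m (s ∘ suc) i)
      R i = rowSum b ((hook s ⊙ n) (suc i)) (s (suc i))
      H = S m (λ j → hookInside (suc L) s 0 j * edge L s n j)
      rearrange : ∀ x y z → x + y + z ≡ y + (x + z)
      rearrange = solve-∀
      row : ∀ i → rowSum (suc b) ((hook (s ∘ suc) ⊙ transfer s n) i) (s (suc i)) ≡ V i + R i
      row i = trans (S-cong′ (suc b) λ p → transfer-hook n i (p + s (suc i)) (m≤n+m _ p))
        (rowSum-insertAt b (antitone₀ anti (suc i))
          (λ j s≤j b≤j → trans (cong (hook s (suc i) j *_) (bd (suc i) j s≤j (inj₂ b≤j))) (*-zeroʳ (hook s (suc i) j)))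
          (λ j s≤j b<j → trans (sym (transfer-hook n i j s≤j))
            (trans (cong (hook (s ∘ suc) i j *_) (transfer-bounded bd i j s≤j (inj₂ b<j))) (*-zeroʳ (hook (s ∘ suc) i j)))))

weight-extend : ∀ {s r c r′ c′ e} → r ≤ r′ → c ≤ c′ → Bounded s r c e → weight s r′ c′ e ≡ weight s r c e
weight-extend {s} {r} {c} {r′} {c′} {e} r≤ c≤ bd = trans
  (S-cong′ r′ λ i → S-extend (λ p → e i (p + s i)) (tail-zero (e i) λ j s≤j c≤j → bd i j s≤j (inj₂ c≤j)) c≤)
  (S-extend (λ i → rowSum c (e i) (s i)) (λ i r≤i → S-zero c λ p _ → bd i _ (m≤n+m (s i) p) (inj₁ r≤i)) r≤)

weight-bound : ∀ {s r c r′ c′ e} → Bounded s r c e → Bounded s r′ c′ e → weight s r c e ≡ weight s r′ c′ e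
weight-bound {r = r} {c} {r′} {c′} bd bd′ = trans
  (sym (weight-extend (m≤m⊔n r r′) (m≤m⊔n c c′) bd)) (weight-extend (m≤n⊔m r r′) (m≤n⊔m c c′) bd′)

Quadrant : ℕ → ℕ
Quadrant = const 0

module _ where
  private
    tail : ∀ {L s} → VanishesFrom (suc L) s → VanishesFrom L (s ∘ suc)
    tail z i le = z (suc i) (s≤s le)

    widen : ∀ {s b e} → Bounded s b (suc b) e → Bounded s (suc b) (suc b) e
    widen = Bounded-mono (n≤1+n _) ≤-refl

  inner-cong : ∀ L {s e f} → Antitone s → Agree s e f → AgreeInside s (inner L s e) (inner L s f)
  inner-cong zero    anti e≗f i       j j<s = refl
  inner-cong (suc L) anti e≗f zero    j j<s = e≗f 0 _ (m≤n+m _ _)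
  inner-cong (suc L) anti e≗f (suc i) j j<s = inner-cong L (anti ∘ suc) (transfer-cong anti e≗f) i j j<s

  outer-cong : ∀ L {s e f} → Antitone s → VanishesFrom L s → Agree s e f → Agree Quadrant (outer L s e) (outer L s f)
  outer-cong zero    anti z e≗f i j _ = e≗f i j (subst (_≤ j) (sym (z i z≤n)) z≤n)
  outer-cong (suc L) anti z e≗f = outer-cong L (anti ∘ suc) (tail z) (transfer-cong anti e≗f)

  outer-bounded : ∀ L {s b n} → Antitone s → VanishesFrom L s → Bounded s b b n →
                  Bounded Quadrant (L + b) (L + b) (outer L s n)
  outer-bounded zero    anti z bd i j _ w = bd i j (subst (_≤ j) (sym (z i z≤n)) z≤n) w
  outer-bounded (suc L) {s} {b} {n} anti z bd =
    subst (λ x → Bounded Quadrant x x (outer (suc L) s n)) (+-suc L b)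
      (outer-bounded L (anti ∘ suc) (tail z) (widen (transfer-bounded anti bd)))

  inner-outer-injective : ∀ L {s e f} → Antitone s → VanishesFrom L s →
    AgreeInside s (inner L s e) (inner L s f) → Agree Quadrant (outer L s e) (outer L s f) → Agree s e f
  inner-outer-injective zero    anti z in≗ out≗ i j _ = out≗ i j z≤n
  inner-outer-injective (suc L) anti z in≗ out≗ = transfer-injective anti z (in≗ 0)
    (inner-outer-injective L (anti ∘ suc) (tail z) (in≗ ∘ suc) out≗)

  inner-outer-surjective : ∀ L {s b m k} → Antitone s → VanishesFrom L s → Bounded Quadrant b b k →
    Σ Array λ n → ∃ (λ b′ → Bounded s b′ b′ n) ×
      AgreeInside s (inner L s n) m × Agree Quadrant (outer L s n) k
  inner-outer-surjective zero {s} {b} {m} {k} anti z bd =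
    k , (b , λ i j _ w → bd i j z≤n w) ,
    (λ i j j<s → contradiction (subst (j <_) (z i z≤n) j<s) λ ()) , λ i j _ → refl
  inner-outer-surjective (suc L) {s} {m = m} anti z bd
    with inner-outer-surjective L {m = m ∘ suc} (anti ∘ suc) (tail z) bd
  ... | n′ , (b′ , bd′) , in≗ , out≗ with transfer-surjective anti z {x = m 0} bd′
  ... | n , bdn , edge≗ , t≗ = n , bdn , in≗′ ,
      λ i j le → trans (outer-cong L (anti ∘ suc) (tail z) t≗ i j le) (out≗ i j le)
    where
    in≗′ : AgreeInside s (inner (suc L) s n) m
    in≗′ zero    j j<s = edge≗ j j<s
    in≗′ (suc i) j j<s = trans (inner-cong L (anti ∘ suc) t≗ i j j<s) (in≗ i j j<s)

  inner-outer-weight : ∀ L {s b c n} → Antitone s → VanishesFrom L s → Bounded s b b n →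
    Bounded Quadrant c c (outer L s n) →
    weight s b b (hook s ⊙ n) ≡
    weightInside L s (hookInside L s ⊙ inner L s n) + weight Quadrant c c (hook Quadrant ⊙ outer L s n)
  inner-outer-weight zero {s} {b} {c} {n} anti z bd bd′ = trans
    (S-cong′ b λ i → trans (cong (rowSum b ((hook s ⊙ n) i)) (z i z≤n)) (S-cong′ b λ p → cong (_* n i (p + 0)) (same i (p + 0))))
    (weight-bound {Quadrant} (⊙-bounded {Quadrant} (hook Quadrant) (outer-bounded zero anti z bd)) (⊙-bounded {Quadrant} (hook Quadrant) bd′))
    where
    same : ∀ i j → hook s i j ≡ hook Quadrant i j
    same i j = cong suc (cong₂ _+_ (cong (j ∸_) (z i z≤n)) (S-cong′ i λ l → cong (λ x → ind x j) (z l z≤n)))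
  inner-outer-weight (suc L) {s} {b} {c} {n} anti z bd bd′ = begin
    weight s b b (hook s ⊙ n)
      ≡⟨ weight-extend (n≤1+n b) ≤-refl (⊙-bounded (hook s) bd) ⟨
    weight s (suc b) b (hook s ⊙ n)
      ≡⟨ transfer-weight anti z bd ⟩
    H + weight (s ∘ suc) b (suc b) (hook (s ∘ suc) ⊙ transfer s n)
      ≡⟨ cong (H +_) (weight-extend (n≤1+n b) ≤-refl (⊙-bounded (hook (s ∘ suc)) (transfer-bounded anti bd))) ⟨
    H + weight (s ∘ suc) (suc b) (suc b) (hook (s ∘ suc) ⊙ transfer s n)
      ≡⟨ cong (H +_) (inner-outer-weight L (anti ∘ suc) (tail z) (widen (transfer-bounded anti bd)) bd′) ⟩
    H + (weightInside L (s ∘ suc) (hookInside L (s ∘ suc) ⊙ inner L (s ∘ suc) (transfer s n)) + O)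
      ≡⟨ +-assoc H _ O ⟨
    weightInside (suc L) s (hookInside (suc L) s ⊙ inner (suc L) s n) + O ∎
    where
    open ≡-Reasoning
    H = S (s 0) (λ j → hookInside (suc L) s 0 j * edge L s n j)
    O = weight Quadrant c c (hook Quadrant ⊙ outer (suc L) s n)

-- Rotating a box

rotate : ℕ → ℕ → Array → Array
rotate L C f i j with i <? L | j <? C
... | yes _ | yes _ = f (L ∸ suc i) (C ∸ suc j)
... | yes _ | no  _ = 0
... | no  _ | _     = 0

rotate-in : ∀ {L C} f {i j} → i < L → j < C → rotate L C f i j ≡ f (L ∸ suc i) (C ∸ suc j)
rotate-in {L} {C} f {i} {j} i<L j<C with i <? L | j <? C
... | yes _   | yes _   = refl
... | yes _   | no  j≮C = contradiction j<C j≮C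
... | no  i≮L | _       = contradiction i<L i≮L

rotate-out : ∀ {L C} f {i j} → L ≤ i ⊎ C ≤ j → rotate L C f i j ≡ 0
rotate-out {L} {C} f {i} {j} out with i <? L | j <? C
... | yes i<L | yes j<C = contradiction out [ <⇒≱ i<L , <⇒≱ j<C ]′
... | yes _   | no  _   = refl
... | no  _   | _       = refl

inBox? : ∀ L C i j → (i < L × j < C) ⊎ (L ≤ i ⊎ C ≤ j)
inBox? L C i j with <-≤-connex i L | <-≤-connex j C
... | inj₁ i<L | inj₁ j<C = inj₁ (i<L , j<C)
... | inj₁ _   | inj₂ C≤j = inj₂ (inj₂ C≤j)
... | inj₂ L≤i | _        = inj₂ (inj₁ L≤i)

reflect-< : ∀ {n i} → i < n → n ∸ suc i < n
reflect-< {suc n} {i} _ = s≤s (m∸n≤m n i)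

suc-reflect : ∀ {n i} → i < n → suc (n ∸ suc i) ≡ n ∸ i
suc-reflect i<n = sym (+-∸-assoc 1 i<n)

reflect-reflect : ∀ {n i} → i < n → n ∸ suc (n ∸ suc i) ≡ i
reflect-reflect {n} {i} i<n = trans (cong (n ∸_) (suc-reflect i<n)) (m∸[m∸n]≡n (<⇒≤ i<n))

rotate-rotate : ∀ {L C} f {i j} → i < L → j < C → rotate L C (rotate L C f) i j ≡ f i j
rotate-rotate {L} {C} f i<L j<C =
  trans (rotate-in (rotate L C f) i<L j<C)
  (trans (rotate-in f (reflect-< i<L) (reflect-< j<C))
         (cong₂ f (reflect-reflect i<L) (reflect-reflect j<C)))

m∸[n∸o]-comm : ∀ {a j n} → a ≤ n → j ≤ n → a ∸ (n ∸ j) ≡ j ∸ (n ∸ a)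
m∸[n∸o]-comm {a} {j} {n} a≤n j≤n = begin
  a ∸ (n ∸ j)           ≡⟨ [m+n]∸[m+o]≡n∸o j a (n ∸ j) ⟨
  j + a ∸ (j + (n ∸ j)) ≡⟨ cong (j + a ∸_) (trans (m+[n∸m]≡n j≤n) (sym (m+[n∸m]≡n a≤n))) ⟩
  j + a ∸ (a + (n ∸ a)) ≡⟨ cong (_∸ (a + (n ∸ a))) (+-comm j a) ⟩
  a + j ∸ (a + (n ∸ a)) ≡⟨ [m+n]∸[m+o]≡n∸o a j (n ∸ a) ⟩
  j ∸ (n ∸ a)           ∎
  where open ≡-Reasoning

m∸n≤o⇒m∸o≤n : ∀ m {n o} → m ∸ n ≤ o → m ∸ o ≤ n
m∸n≤o⇒m∸o≤n m {n} {o} le = m≤n+o⇒m∸n≤o m o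
  (subst (m ≤_) (+-comm n o) (≤-trans (m≤n+m∸n m n) (+-monoʳ-≤ n le)))

ind-reflect : ∀ n a j → ind (n ∸ a) j ≡ ind (n ∸ j) a
ind-reflect n a j with <-≤-connex j (n ∸ a)
... | inj₂ n∸a≤j = trans (ind-≤ n∸a≤j) (sym (ind-≤ (m∸n≤o⇒m∸o≤n n n∸a≤j)))
... | inj₁ j<n∸a with <-≤-connex a (n ∸ j)
...   | inj₁ a<n∸j = trans (ind-> j<n∸a) (sym (ind-> a<n∸j))
...   | inj₂ n∸j≤a = contradiction (m∸n≤o⇒m∸o≤n n n∸j≤a) (<⇒≱ j<n∸a)

module Rotation {s : ℕ → ℕ} (anti : Antitone s) {L C : ℕ} (s-zero : VanishesFrom L s) (s≤C : s 0 ≤ C) where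

  part≤C : ∀ i → s i ≤ C
  part≤C i = ≤-trans (antitone₀ anti i) s≤C

  rows : ∀ {i j} → j < s i → i < L
  rows {i} {j} j<s with <-≤-connex i L
  ... | inj₁ i<L = i<L
  ... | inj₂ L≤i = contradiction (subst (j <_) (s-zero i L≤i) j<s) λ ()

  columns : ∀ {i j} → j < s i → j < C
  columns j<s = ≤-trans j<s (part≤C _)

  complement : ℕ → ℕ
  complement i = C ∸ s (L ∸ suc i)

  complement-antitone : Antitone complement
  complement-antitone i = ∸-monoʳ-≤ C (step L i)
    where
    step : ∀ L i → s (L ∸ suc i) ≤ s (L ∸ suc (suc i))
    step zero          i       = ≤-refl
    step (suc zero)    zero    = ≤-refl
    step (suc (suc L)) zero    = anti L
    step (suc L)       (suc i) = step L i

  inside : ∀ {i j} → j < C → complement i ≤ j → C ∸ suc j < s (L ∸ suc i)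
  inside {i} {j} j<C le = subst (_≤ s (L ∸ suc i)) (sym (suc-reflect j<C)) (m∸n≤o⇒m∸o≤n C le)

  outside : ∀ {i j} → i < L → j < s i → complement (L ∸ suc i) ≤ C ∸ suc j
  outside i<L j<s = ∸-monoʳ-≤ C (subst (λ x → suc _ ≤ s x) (sym (reflect-reflect i<L)) j<s)

  rotate-bounded : ∀ f → Bounded complement L C (rotate L C f)
  rotate-bounded f i j _ out = rotate-out f out

  rotate-outward : ∀ {f g} → AgreeInside s f g → Agree complement (rotate L C f) (rotate L C g)
  rotate-outward {f} {g} f≗g i j le with inBox? L C i j
  ... | inj₁ (i<L , j<C) = trans (rotate-in f i<L j<C) (trans (f≗g _ _ (inside j<C le)) (sym (rotate-in g i<L j<C)))
  ... | inj₂ out         = trans (rotate-out f out) (sym (rotate-out g out))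

  rotate-inward : ∀ {f g} → Agree complement f g → AgreeInside s (rotate L C f) (rotate L C g)
  rotate-inward {f} {g} f≗g i j j<s =
    trans (rotate-in f (rows j<s) (columns j<s))
    (trans (f≗g _ _ (outside (rows j<s) j<s)) (sym (rotate-in g (rows j<s) (columns j<s))))

  rotate²-inside : ∀ f → AgreeInside s (rotate L C (rotate L C f)) f
  rotate²-inside f i j j<s = rotate-rotate f (rows j<s) (columns j<s)

  rotate²-outside : ∀ {f} → Bounded complement L C f → Agree complement (rotate L C (rotate L C f)) f
  rotate²-outside {f} bd i j le with inBox? L C i j
  ... | inj₁ (i<L , j<C) = rotate-rotate f i<L j<C
  ... | inj₂ out         = trans (rotate-out (rotate L C f) out) (sym (bd i j le out))

  rotate-skew : ∀ {f} → (∀ i j → j < s (suc i) → f i j ≤ f (suc i) j) → (∀ i j → suc j < s i → f i j ≤ f i (suc j)) →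
                IsSkew complement (rotate L C f)
  rotate-skew {f} f-down f-right .down i j le with inBox? L C (suc i) j
  ... | inj₂ out = subst (_≤ rotate L C f i j) (sym (rotate-out f out)) z≤n
  ... | inj₁ (i<L , j<C) = subst₂ _≤_ (sym (rotate-in f i<L j<C))
      (trans (cong (λ x → f x (C ∸ suc j)) (suc-reflect i<L)) (sym (rotate-in f (<⇒≤ i<L) j<C)))
      (f-down _ _ (subst (λ x → C ∸ suc j < s x) (sym (suc-reflect i<L)) (inside j<C le)))
  rotate-skew {f} f-down f-right .right i j le with inBox? L C i (suc j)
  ... | inj₂ out = subst (_≤ rotate L C f i j) (sym (rotate-out f out)) z≤n
  ... | inj₁ (i<L , j<C) = subst₂ _≤_ (sym (rotate-in f i<L j<C))
      (trans (cong (f (L ∸ suc i)) (suc-reflect j<C)) (sym (rotate-in f i<L (<⇒≤ j<C))))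
      (f-right _ _ (subst (_< s (L ∸ suc i)) (sym (suc-reflect j<C)) (inside (<⇒≤ j<C) le)))

  rotate-down : ∀ {e} → IsSkew complement e → ∀ i j → j < s (suc i) → rotate L C e i j ≤ rotate L C e (suc i) j
  rotate-down {e} sk i j j<s = subst₂ _≤_
    (trans (cong (λ x → e x (C ∸ suc j)) (suc-reflect (rows j<s))) (sym (rotate-in e (<⇒≤ (rows j<s)) (columns j<s))))
    (sym (rotate-in e (rows j<s) (columns j<s)))
    (down sk _ _ (outside (rows j<s) j<s))

  rotate-right : ∀ {e} → IsSkew complement e → ∀ i j → suc j < s i → rotate L C e i j ≤ rotate L C e i (suc j)
  rotate-right {e} sk i j j<s = subst₂ _≤_
    (trans (cong (e (L ∸ suc i)) (suc-reflect (columns j<s))) (sym (rotate-in e (rows j<s) (<⇒≤ (columns j<s)))))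
    (sym (rotate-in e (rows j<s) (columns j<s)))
    (right sk _ _ (outside (rows j<s) j<s))

  rotate-weight : ∀ f → weightInside L s f ≡ weight complement L C (rotate L C f)
  rotate-weight f = trans (S-rev L λ i → S (s i) (f i)) (S-cong L row)
    where
    open ≡-Reasoning
    row : ∀ i → i < L → S (s (L ∸ suc i)) (f (L ∸ suc i)) ≡ rowSum C (rotate L C f i) (complement i)
    row i i<L = begin
      S a (f i′)                                     ≡⟨ S-rev a (f i′) ⟩
      S a (λ p → f i′ (a ∸ suc p))                   ≡⟨ S-cong a cell ⟩
      S a (λ p → rotate L C f i (p + (C ∸ a)))       ≡⟨ S-extend (λ p → rotate L C f i (p + (C ∸ a))) beyond (part≤C i′) ⟨
      rowSum C (rotate L C f i) (complement i)       ∎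
      where
      i′ = L ∸ suc i
      a = s i′
      cell : ∀ p → p < a → f i′ (a ∸ suc p) ≡ rotate L C f i (p + (C ∸ a))
      cell p p<a = sym (trans (rotate-in f i<L (subst (suc p + (C ∸ a) ≤_) (m+[n∸m]≡n (part≤C i′)) (+-monoˡ-≤ (C ∸ a) p<a)))
        (cong (f i′) (begin
          C ∸ (suc p + (C ∸ a))   ≡⟨ cong (C ∸_) (+-comm (suc p) (C ∸ a)) ⟩
          C ∸ (C ∸ a + suc p)     ≡⟨ ∸-+-assoc C (C ∸ a) (suc p) ⟨
          C ∸ (C ∸ a) ∸ suc p     ≡⟨ cong (_∸ suc p) (m∸[m∸n]≡n (part≤C i′)) ⟩
          a ∸ suc p               ∎)))
      beyond : VanishesFrom a (λ p → rotate L C f i (p + (C ∸ a)))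
      beyond p a≤p = rotate-out {L} f {i} (inj₂ (subst (_≤ p + (C ∸ a)) (m+[n∸m]≡n (part≤C i′)) (+-monoˡ-≤ (C ∸ a) a≤p)))

  rotate-hook : ∀ {i j} → i < L → j < C → hookInside L s (L ∸ suc i) (C ∸ suc j) ≡ hook complement i j
  rotate-hook {i} {j} i<L j<C = cong suc (cong₂ _+_ arm leg)
    where
    open ≡-Reasoning
    i′ = L ∸ suc i
    arm : s i′ ∸ suc (C ∸ suc j) ≡ j ∸ complement i
    arm = trans (cong (s i′ ∸_) (suc-reflect j<C)) (m∸[n∸o]-comm (part≤C i′) (<⇒≤ j<C))
    index : ∀ l → l < i → L ∸ suc (i ∸ suc l) ≡ suc i′ + l
    index l l<i = begin
      L ∸ suc (i ∸ suc l)   ≡⟨ cong (L ∸_) (suc-reflect l<i) ⟩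
      L ∸ (i ∸ l)           ≡⟨ cong (_∸ (i ∸ l)) (m∸n+n≡m (<⇒≤ i<L)) ⟨
      L ∸ i + i ∸ (i ∸ l)   ≡⟨ +-∸-assoc (L ∸ i) (m∸n≤m i l) ⟩
      L ∸ i + (i ∸ (i ∸ l)) ≡⟨ cong₂ _+_ (sym (suc-reflect i<L)) (m∸[m∸n]≡n (<⇒≤ l<i)) ⟩
      suc i′ + l            ∎
    leg : S (L ∸ suc i′) (λ l → ind (suc (C ∸ suc j)) (s (suc i′ + l))) ≡ S i (λ l → ind (complement l) j)
    leg = begin
      S (L ∸ suc i′) (λ l → ind (suc (C ∸ suc j)) (s (suc i′ + l)))
        ≡⟨ cong₂ (λ x y → S x (λ l → ind y (s (suc i′ + l)))) (reflect-reflect i<L) (suc-reflect j<C) ⟩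
      S i (λ l → ind (C ∸ j) (s (suc i′ + l)))
        ≡⟨ S-cong i (λ l l<i → trans (cong (λ x → ind (C ∸ j) (s x)) (sym (index l l<i))) (sym (ind-reflect C _ j))) ⟩
      S i (λ l → ind (complement (i ∸ suc l)) j)
        ≡⟨ S-rev i (λ l → ind (complement l) j) ⟨
      S i (λ l → ind (complement l) j) ∎

  params-rotate-weight : ∀ {f n} → Bounded complement L C n →
    weight complement L C (rotate L C f) ≡ weight complement L C (hook complement ⊙ n) →
    weightInside L s f ≡ weightInside L s (hookInside L s ⊙ rotate L C n)
  params-rotate-weight {f} {n} bd eq = begin
    weightInside L s f                                                      ≡⟨ rotate-weight f ⟩
    weight complement L C (rotate L C f)                                    ≡⟨ eq ⟩
    weight complement L C (hook complement ⊙ n)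
      ≡⟨ S-cong′ L (λ i → S-cong′ C λ p → sym (cell i _ (m≤n+m _ p))) ⟩
    weight complement L C (rotate L C (hookInside L s ⊙ rotate L C n))      ≡⟨ rotate-weight _ ⟨
    weightInside L s (hookInside L s ⊙ rotate L C n)                        ∎
    where
    open ≡-Reasoning
    cell : Agree complement (rotate L C (hookInside L s ⊙ rotate L C n)) (hook complement ⊙ n)
    cell i j le with inBox? L C i j
    ... | inj₁ (i<L , j<C) = trans (rotate-in (hookInside L s ⊙ rotate L C n) i<L j<C)
        (cong₂ _*_ (rotate-hook i<L j<C) (trans (rotate-in n (reflect-< i<L) (reflect-< j<C))
          (cong₂ n (reflect-reflect i<L) (reflect-reflect j<C))))
    ... | inj₂ out = trans (rotate-out (hookInside L s ⊙ rotate L C n) out)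
        (sym (trans (cong (hook complement i j *_) (bd i j le out)) (*-zeroʳ (hook complement i j))))

FreeOutside : (s : ℕ → ℕ) → Setoid 0ℓ 0ℓ
FreeOutside s = record
  { Carrier       = Σ Array λ n → ∃ λ b → Bounded s b b n
  ; _≈_           = λ m n → Agree s (proj₁ m) (proj₁ n)
  ; isEquivalence = record
    { refl  = λ i j _ → refl
    ; sym   = λ p i j le → sym (p i j le)
    ; trans = λ p q i j le → trans (p i j le) (q i j le)
    }
  }

FreeInside : (s : ℕ → ℕ) → Setoid 0ℓ 0ℓ
FreeInside s = record
  { Carrier       = Array
  ; _≈_           = AgreeInside s
  ; isEquivalence = record
    { refl  = λ i j _ → refl
    ; sym   = λ p i j lt → sym (p i j lt)
    ; trans = λ p q i j lt → trans (p i j lt) (q i j lt)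
    }
  }

outsideWeight : (s : ℕ → ℕ) → Setoid.Carrier (FreeOutside s) → ℕ
outsideWeight s (n , b , _) = weight s b b (hook s ⊙ n)

insideWeight : ℕ → (s : ℕ → ℕ) → Array → ℕ
insideWeight L s n = weightInside L s (hookInside L s ⊙ n)

outsideWeight-cong : ∀ {s} m n → Setoid._≈_ (FreeOutside s) m n →
                     outsideWeight s m ≡ outsideWeight s n
outsideWeight-cong {s} (m , a , bm) (n , b , bn) m≗n = trans
  (S-cong′ a λ i → S-cong′ a λ p → cong (hook s i (p + s i) *_) (m≗n i _ (m≤n+m _ p)))
  (weight-bound (⊙-bounded (hook s) λ i j le out → trans (sym (m≗n i j le)) (bm i j le out))
                (⊙-bounded (hook s) bn))

insideWeight-cong : ∀ L {s m n} → AgreeInside s m n → insideWeight L s m ≡ insideWeight L s n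
insideWeight-cong L {s} m≗n = S-cong′ L λ i → S-cong (s i) λ j j<s → cong (hookInside L s i j *_) (m≗n i j j<s)

bijection : (X Y : Setoid 0ℓ 0ℓ) → let module X = Setoid X; module Y = Setoid Y in
  (to : X.Carrier → Y.Carrier) → (∀ {x y} → x X.≈ y → to x Y.≈ to y) →
  (∀ {x y} → to x Y.≈ to y → x X.≈ y) → (∀ y → ∃ λ x → to x Y.≈ y) → Bijection X Y
bijection X Y to cong inj surj = record
  { to = to ; cong = cong ; bijective = inj , strictlySurjective⇒surjective X Y cong surj }

-- Plane partitions outside a diagram

module _ (μ : Partition) where
  open Partition μ

  outside-region : ∀ i j → .(¬ InDiagram μ i j) → part i ≤ j
  outside-region i j c = ≮⇒≥ (recompute (¬? (j <? part i)) c)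

  extendByZero-outside : ∀ σ i j .(c : ¬ InDiagram μ i j) → SPP.extendByZero {μ} σ i j ≡ SPP.entry σ i j c
  extendByZero-outside σ i j c with j <? part i
  ... | yes j<s = contradiction (outside-region i j c) (<⇒≱ j<s)
  ... | no  _   = refl

  extendByZero-inside : ∀ σ i j → InDiagram μ i j → SPP.extendByZero {μ} σ i j ≡ 0
  extendByZero-inside σ i j j<s with j <? part i
  ... | yes _   = refl
  ... | no  j≮s = contradiction j<s j≮s

  SPP-skew : ∀ σ → IsSkew part (SPP.extendByZero {μ} σ)
  SPP-skew σ .down i j le = subst₂ _≤_
    (sym (extendByZero-outside σ (suc i) j (≤⇒≯ (≤-trans (decreasing i) le))))
    (sym (extendByZero-outside σ i j (≤⇒≯ le))) (SPP.down σ i j _ _)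
  SPP-skew σ .right i j le = subst₂ _≤_
    (sym (extendByZero-outside σ i (suc j) (≤⇒≯ (m≤n⇒m≤1+n le))))
    (sym (extendByZero-outside σ i j (≤⇒≯ le))) (SPP.right σ i j _ _)

  SPP-bounded : ∀ σ → Bounded part (SPP.bound {μ} σ) (SPP.bound σ) (SPP.extendByZero σ)
  SPP-bounded σ i j le out = trans (extendByZero-outside σ i j (≤⇒≯ le)) (SPP.support σ i j _ out)

  SPP-weight : ∀ σ → SPP.weight {μ} σ ≡ weight part (SPP.bound σ) (SPP.bound σ) (SPP.extendByZero σ)
  SPP-weight σ = S-cong b λ i _ → begin
    S b (e i)
      ≡⟨ S-splitAt (part i) b (e i) (vanishes i) ⟩
    S (part i) (e i) + S b (λ p → e i (part i + p))
      ≡⟨ cong₂ _+_ (S-zero (part i) λ j j<s → extendByZero-inside σ i j j<s) (S-cong′ b λ p → cong (e i) (+-comm (part i) p)) ⟩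
    rowSum b (e i) (part i) ∎
    where
    open ≡-Reasoning
    b = SPP.bound σ
    e = SPP.extendByZero σ
    vanishes : ∀ i → VanishesFrom b (e i)
    vanishes i j b≤j with <-≤-connex j (part i)
    ... | inj₁ j<s = extendByZero-inside σ i j j<s
    ... | inj₂ s≤j = SPP-bounded σ i j s≤j (inj₂ b≤j)

  fromArray : ∀ {e b} → IsSkew part e → Bounded part b b e → SPP μ
  fromArray {e} {b} sk bd = record
    { entry   = λ i j _ → e i j
    ; down    = λ i j c _ → down sk i j (outside-region i j c)
    ; right   = λ i j c _ → right sk i j (outside-region i j c)
    ; bound   = b
    ; support = λ i j c → bd i j (outside-region i j c)
    }

  SPP-bijection : Bijection (SPPₛ μ) (FreeOutside part)
  SPP-bijection = bijection (SPPₛ μ) (FreeOutside part)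
    (λ σ → params part (SPP.extendByZero σ) , SPP.bound σ , params-bounded decreasing (SPP-skew σ) (SPP-bounded σ))
    (λ {σ} {τ} σ≈τ → params-cong decreasing λ i j le →
      trans (extendByZero-outside σ i j (≤⇒≯ le)) (trans (σ≈τ i j (≤⇒≯ le)) (sym (extendByZero-outside τ i j (≤⇒≯ le)))))
    (λ {σ} {τ} eq i j c →
      let b = SPP.bound σ ⊔ SPP.bound τ
          bσ = m≤m⊔n (SPP.bound σ) (SPP.bound τ)
          bτ = m≤n⊔m (SPP.bound σ) (SPP.bound τ)
      in trans (sym (extendByZero-outside σ i j c))
         (trans (params-injective b {c = b} decreasing (SPP-skew σ) (SPP-skew τ) (Bounded-mono bσ bσ (SPP-bounded σ))
                  (Bounded-mono bτ bτ (SPP-bounded τ)) eq i j (outside-region i j c))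
                (extendByZero-outside τ i j c)))
    (λ (n , b , bd) → let e , sk , bde , eq = params-surjective b decreasing bd
                          σ = fromArray sk bde
      in σ , λ i j le → trans (params-cong decreasing (λ i j le → extendByZero-outside σ i j (≤⇒≯ le)) i j le) (eq i j le))

  SPP-bijection-weight : ∀ σ → SPP.weight σ ≡ outsideWeight part (Bijection.to SPP-bijection σ)
  SPP-bijection-weight σ = trans (SPP-weight σ) (weight-params _ decreasing (SPP-skew σ) (SPP-bounded σ))

quadrant : Antitone Quadrant
quadrant _ = z≤n

PP-skew : ∀ π → IsSkew Quadrant (PP.entry π)
PP-skew π = record { down = λ i j _ → PP.down π i j ; right = λ i j _ → PP.right π i j }

PP-bounded : ∀ π → Bounded Quadrant (PP.bound π) (PP.bound π) (PP.entry π)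
PP-bounded π i j _ = PP.support π i j

PP-bijection : Bijection PPₛ (FreeOutside Quadrant)
PP-bijection = bijection PPₛ (FreeOutside Quadrant)
  (λ π → params Quadrant (PP.entry π) , PP.bound π , params-bounded quadrant (PP-skew π) (PP-bounded π))
  (λ π≈π′ → params-cong quadrant λ i j _ → π≈π′ i j)
  (λ {π} {π′} eq i j →
    let b = PP.bound π ⊔ PP.bound π′
        bπ = m≤m⊔n (PP.bound π) (PP.bound π′)
        bπ′ = m≤n⊔m (PP.bound π) (PP.bound π′)
    in params-injective b {c = b} quadrant (PP-skew π) (PP-skew π′) (Bounded-mono bπ bπ (PP-bounded π))
         (Bounded-mono bπ′ bπ′ (PP-bounded π′)) eq i j z≤n)
  (λ (n , b , bd) → let e , sk , bde , eq = params-surjective b quadrant bd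
    in record { entry = e ; down = λ i j → down sk i j z≤n ; right = λ i j → right sk i j z≤n
              ; bound = b ; support = λ i j → bde i j z≤n } , eq)

PP-bijection-weight : ∀ π → PP.weight π ≡ outsideWeight Quadrant (Bijection.to PP-bijection π)
PP-bijection-weight π = trans
  (S-cong′ (PP.bound π) λ i → S-cong′ (PP.bound π) λ j → cong (PP.entry π i) (sym (+-identityʳ j)))
  (weight-params _ quadrant (PP-skew π) (PP-bounded π))

-- Reverse plane partitions

module _ (μ : Partition) where
  open Partition μ
  open Rotation {part} decreasing {length} {part 0} finite ≤-refl

  private
    turn = rotate length (part 0)

  total : RPP μ → Array
  total ρ i j with j <? part i
  ... | yes c = RPP.entry ρ i j c
  ... | no  _ = 0

  total-inside : ∀ ρ i j .(c : InDiagram μ i j) → total ρ i j ≡ RPP.entry ρ i j c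
  total-inside ρ i j c with j <? part i
  ... | yes _   = refl
  ... | no  j≮s = contradiction (recompute (j <? part i) c) j≮s

  RPP-skew : ∀ ρ → IsSkew complement (turn (total ρ))
  RPP-skew ρ = rotate-skew
    (λ i j j<s → subst₂ _≤_ (sym (total-inside ρ i j (≤-trans j<s (decreasing i)))) (sym (total-inside ρ (suc i) j j<s))
      (RPP.down ρ i j _ _))
    (λ i j j<s → subst₂ _≤_ (sym (total-inside ρ i j (<⇒≤ j<s))) (sym (total-inside ρ i (suc j) j<s))
      (RPP.right ρ i j _ _))

  RPP-params : RPP μ → Array
  RPP-params ρ = params complement (turn (total ρ))

  RPP-params-bounded : ∀ ρ → Bounded complement length (part 0) (RPP-params ρ)
  RPP-params-bounded ρ = params-bounded complement-antitone (RPP-skew ρ) (rotate-bounded (total ρ))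

  RPP-bijection : Bijection (RPPₛ μ) (FreeInside part)
  RPP-bijection = bijection (RPPₛ μ) (FreeInside part) (turn ∘ RPP-params) congruent injective surjective
    where
    congruent : ∀ {ρ ρ′} → Setoid._≈_ (RPPₛ μ) ρ ρ′ → AgreeInside part (turn (RPP-params ρ)) (turn (RPP-params ρ′))
    congruent {ρ} {ρ′} ρ≈ρ′ = rotate-inward (params-cong complement-antitone (rotate-outward λ i j c →
      trans (total-inside ρ i j c) (trans (ρ≈ρ′ i j c) (sym (total-inside ρ′ i j c)))))
    injective : ∀ {ρ ρ′} → AgreeInside part (turn (RPP-params ρ)) (turn (RPP-params ρ′)) → Setoid._≈_ (RPPₛ μ) ρ ρ′
    injective {ρ} {ρ′} eq i j c = begin
      RPP.entry ρ i j c             ≡⟨ total-inside ρ i j c ⟨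
      total ρ i j                   ≡⟨ rotate²-inside (total ρ) i j c′ ⟨
      turn (turn (total ρ)) i j     ≡⟨ rotate-inward total≗ i j c′ ⟩
      turn (turn (total ρ′)) i j    ≡⟨ rotate²-inside (total ρ′) i j c′ ⟩
      total ρ′ i j                  ≡⟨ total-inside ρ′ i j c ⟩
      RPP.entry ρ′ i j c            ∎
      where
      open ≡-Reasoning
      c′ : InDiagram μ i j
      c′ = recompute (j <? part i) c
      params≗ : Agree complement (RPP-params ρ) (RPP-params ρ′)
      params≗ i j le = trans (sym (rotate²-outside (RPP-params-bounded ρ) i j le))
        (trans (rotate-outward eq i j le) (rotate²-outside (RPP-params-bounded ρ′) i j le))
      total≗ : Agree complement (turn (total ρ)) (turn (total ρ′))
      total≗ = params-injective length complement-antitone (RPP-skew ρ) (RPP-skew ρ′)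
        (rotate-bounded (total ρ)) (rotate-bounded (total ρ′)) params≗
    surjective : ∀ m → ∃ λ ρ → AgreeInside part (turn (RPP-params ρ)) m
    surjective m with params-surjective length complement-antitone (rotate-bounded m)
    ... | e , sk , bd , eq = ρ , λ i j c → trans (rotate-inward params≗ i j c) (rotate²-inside m i j c)
      where
      ρ : RPP μ
      ρ = record
        { entry = λ i j _ → turn e i j
        ; down  = λ i j _ c → rotate-down sk i j (recompute (j <? part (suc i)) c)
        ; right = λ i j _ c → rotate-right sk i j (recompute (suc j <? part i) c)
        }
      params≗ : Agree complement (RPP-params ρ) (turn m)
      params≗ i j le = trans (params-cong complement-antitone
        (λ i j le → trans (rotate-outward (λ i j c → total-inside ρ i j c) i j le) (rotate²-outside bd i j le)) i j le)
        (eq i j le)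

  RPP-weight : ∀ ρ → RPP.weight ρ ≡ weightInside length part (total ρ)
  RPP-weight ρ = sum-cong-≗ {length} λ i → sum-cong-≗ {part (toℕ i)} λ j →
    sym (total-inside ρ (toℕ i) (toℕ j) (toℕ<n j))

  RPP-bijection-weight : ∀ ρ → RPP.weight ρ ≡ insideWeight length part (Bijection.to RPP-bijection ρ)
  RPP-bijection-weight ρ = trans (RPP-weight ρ) (params-rotate-weight (RPP-params-bounded ρ)
    (weight-params length complement-antitone (RPP-skew ρ) (rotate-bounded (total ρ))))

module _ (μ : Partition) where
  open Partition μ

  cell-bijection : Bijection (FreeOutside part) (FreeInside part ×ₛ FreeOutside Quadrant)
  cell-bijection = bijection (FreeOutside part) (FreeInside part ×ₛ FreeOutside Quadrant)
    (λ (n , b , bd) → inner length part n , outer length part n , length + b , outer-bounded length decreasing finite bd)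
    (λ eq → inner-cong length decreasing eq , outer-cong length decreasing finite eq)
    (λ (in≗ , out≗) → inner-outer-injective length decreasing finite in≗ out≗)
    (λ (m , k , b , bd) → let n , bn , in≗ , out≗ = inner-outer-surjective length {m = m} decreasing finite bd
      in (n , bn) , in≗ , out≗)

  cell-bijection-weight : ∀ n → let m , k = Bijection.to cell-bijection n in
    outsideWeight part n ≡ insideWeight length part m + outsideWeight Quadrant k
  cell-bijection-weight (n , b , bd) =
    inner-outer-weight length decreasing finite bd (outer-bounded length decreasing finite bd)

theorem4p9 : (μ : Partition) →
    Σ (Bijection (SPPₛ μ) (RPPₛ μ ×ₛ PPₛ)) λ f →
    (σ : SPP μ) →
    SPP.weight σ ≡ RPP.weight (proj₁ (Bijection.to f σ)) + PP.weight (proj₂ (Bijection.to f σ))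
theorem4p9 μ = Composition.bijection to-free (Inverse⇒Bijection (Symmetry.inverse pairs)) , preserves
  where
  open Partition μ
  open ≡-Reasoning
  to-free : Bijection (SPPₛ μ) (FreeInside part ×ₛ FreeOutside Quadrant)
  to-free = Composition.bijection (SPP-bijection μ) (cell-bijection μ)
  pairs : Inverse (RPPₛ μ ×ₛ PPₛ) (FreeInside part ×ₛ FreeOutside Quadrant)
  pairs = Bijection⇒Inverse (RPP-bijection μ ×-bijection PP-bijection)
  preserves : ∀ σ → _
  preserves σ = begin
    SPP.weight σ
      ≡⟨ SPP-bijection-weight μ σ ⟩
    outsideWeight part (Bijection.to (SPP-bijection μ) σ)
      ≡⟨ cell-bijection-weight μ (Bijection.to (SPP-bijection μ) σ) ⟩
    insideWeight length part (proj₁ x) + outsideWeight Quadrant (proj₂ x)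
      ≡⟨ cong₂ _+_ (insideWeight-cong length (proj₁ back)) (outsideWeight-cong (Bijection.to PP-bijection π) (proj₂ x) (proj₂ back)) ⟨
    insideWeight length part (Bijection.to (RPP-bijection μ) ρ) + outsideWeight Quadrant (Bijection.to PP-bijection π)
      ≡⟨ cong₂ _+_ (RPP-bijection-weight μ ρ) (PP-bijection-weight π) ⟨
    RPP.weight ρ + PP.weight π ∎
    where
    x = Bijection.to to-free σ
    ρ = proj₁ (Inverse.from pairs x)
    π = proj₂ (Inverse.from pairs x)
    back = Inverse.strictlyInverseˡ pairs x
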